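{- Fix $\alpha\in[\tfrac12,1)$. An ideal SAIT for $n$ keys with total number of accesses $m$ can be built in $O(m)$ time and uses $O(m^{\alpha/2}\cdot n + m^{\alpha})$ memory.
   Context: A Generic Self-Adjusting Tree (GSAT) with degree function $D$ for a set of integer keys with access counts $ac_i\ge1$ consists of $m=\sum_i ac_i$, an array of $k\le\lceil D(m)\rceil$ representative keys with their access counts, and $k+1$ child subtrees that are GSATs for the keys lying strictly before the first representative, strictly between consecutive representatives, and strictly after the last; every node stores at least one key (empty key sets give no node), so the tree has at most $n$ nodes. $m(T')$ is the total access count of keys in subtree $T'$. A GSAT is ideal if each child $T_j$ of the root satisfies $m(T_j)\le m/(D(m)+1)$ and each child is ideal. A SAIT (Self-Adjusting Interpolation Search Tree) is a GSAT with $D(m)=\sqrt m$ in which, additionally, each node whose subtree has total access count $m'$ stores an interpolation array $ID$ of size $\lceil m'^{\alpha}\rceil$, which is built in $O(m'^{\alpha})$ time after the node's representatives are chosen. Cost model for the rest of construction: given keys sorted with prefix sums of access counts, a node with subtree access count $m'$ costs $O(D(m'))$ time and memory plus $O(\log n)$ time per representative (binary search on prefix sums), besides recursive construction of its children.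
   Formalization: The O(log n) time per representative is charged with n the number of keys in the subtree being built; with n the total number of keys the cost model allows n log n when all access counts are 1, so O(m) would fail. -}

module Defs where

open import Algebra.Definitions.RawSemiring using (_^_)
open import Data.Empty using (⊥-elim)
open import Data.Fin.Base using (Fin)
open import Data.Integer.Base as ℤ using (ℤ; +_; ∣_∣)
import Data.Integer.Properties as ℤₚ
open import Data.List.Base as List using (List; []; _∷_; _++_)
open import Data.List.Relation.Unary.All using (All)
open import Data.List.Relation.Unary.Linked using (Linked)
open import Data.Nat.Base as ℕ using (ℕ; zero; suc)
open import Data.Nat.Logarithm using (⌊log₂_⌋)
import Data.Nat.Properties as ℕₚ
open import Data.Product.Base using (_×_; _,_; proj₁; proj₂; ∃; ∃₂)
open import Data.Rational.Base as ℚ using (ℚ; mkℚ; 0ℚ; 1ℚ; ½; ↥_; ↧ₙ_; *≤*; *<*; nonNegative; positive)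
open import Data.Rational.Literals using (fromℤ)
import Data.Rational.Properties as ℚₚ
open import Data.Sum.Base using (_⊎_; inj₁; inj₂)
open import Data.Unit.Base using (⊤; tt)
open import Data.Vec.Base as Vec using (Vec; []; _∷_; lookup)
open import Relation.Binary.Definitions using (tri<; tri≈; tri>)
open import Relation.Binary.PropositionalEquality
open import Relation.Nullary.Negation using (¬_)

infixr 8 _^ℚ_
_^ℚ_ : ℚ → ℕ → ℚ
_^ℚ_ = _^_ ℚ.+-*-rawSemiring

ℕ→ℚ : ℕ → ℚ
ℕ→ℚ n = fromℤ (+ n)

ℚ-<⇒≱ : ∀ {p q} → p ℚ.< q → ¬ q ℚ.≤ p
ℚ-<⇒≱ p<q q≤p = ℚₚ.<-irrefl refl (ℚₚ.<-≤-trans p<q q≤p)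

------------------------------------------------------------------------
-- Real numbers as Dedekind cuts.  As in the classical one-sided
-- presentation, x is given by the open lower set { r ∈ ℚ ∣ x > r }.

record ℝ : Set₁ where
  infix 4 _>ℚ_
  field
    _>ℚ_      : ℚ → Set
    inhabited : ∃ λ r → _>ℚ_ r
    bounded   : ∃ λ r → ¬ _>ℚ_ r
    downward  : ∀ {r s} → r ℚ.< s → _>ℚ_ s → _>ℚ_ r
    open-cut  : ∀ {r} → _>ℚ_ r → ∃ λ s → r ℚ.< s × _>ℚ_ s

open ℝ public using (_>ℚ_)

>ℚ∧≯ℚ⇒< : ∀ x {r s} → x >ℚ r → ¬ x >ℚ s → r ℚ.< s
>ℚ∧≯ℚ⇒< x {r} {s} x>r x≯s with ℚₚ.<-cmp r s
... | tri< r<s _ _  = r<s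
... | tri≈ _ refl _ = ⊥-elim (x≯s x>r)
... | tri> _ _ s<r  = ⊥-elim (x≯s (ℝ.downward x s<r x>r))

infix 4 _≤ᴿ_ _<ᴿ_

_≤ᴿ_ : ℝ → ℝ → Set
x ≤ᴿ y = ∀ r → x >ℚ r → y >ℚ r

_<ᴿ_ : ℝ → ℝ → Set
x <ᴿ y = ∃ λ r → ¬ x >ℚ r × y >ℚ r

r-1<r : ∀ r → r ℚ.- 1ℚ ℚ.< r
r-1<r r = subst (r ℚ.- 1ℚ ℚ.<_) (ℚₚ.+-identityʳ r) (ℚₚ.+-monoʳ-< r (*<* ℤ.-<+))

sup : (S : ℚ → Set) → ∃ S → (∃ λ b → ∀ t → S t → t ℚ.≤ b) → ℝ
sup S (t₀ , t₀∈S) (b , S≤b) = record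
  { _>ℚ_      = λ r → ∃ λ t → S t × r ℚ.< t
  ; inhabited = t₀ ℚ.- 1ℚ , t₀ , t₀∈S , r-1<r t₀
  ; bounded   = b , λ (t , t∈S , b<t) → ℚ-<⇒≱ b<t (S≤b t t∈S)
  ; downward  = λ r<s (t , t∈S , s<t) → t , t∈S , ℚₚ.<-trans r<s s<t
  ; open-cut  = λ (t , t∈S , r<t) → let (s , r<s , s<t) = ℚₚ.<-dense r<t in s , r<s , t , t∈S , s<t
  }

ℚ→ℝ : ℚ → ℝ
ℚ→ℝ q = record
  { _>ℚ_      = ℚ._< q
  ; inhabited = q ℚ.- 1ℚ , r-1<r q
  ; bounded   = q , ℚₚ.<-irrefl refl
  ; downward  = ℚₚ.<-trans
  ; open-cut  = ℚₚ.<-dense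
  }

ℕ→ℝ : ℕ → ℝ
ℕ→ℝ n = ℚ→ℝ (ℕ→ℚ n)

p+[r-p] : ∀ p r → p ℚ.+ (r ℚ.- p) ≡ r
p+[r-p] p r = begin
  p ℚ.+ (r ℚ.- p)        ≡⟨ cong (p ℚ.+_) (ℚₚ.+-comm r (ℚ.- p)) ⟩
  p ℚ.+ (ℚ.- p ℚ.+ r)    ≡⟨ ℚₚ.+-assoc p (ℚ.- p) r ⟨
  (p ℚ.- p) ℚ.+ r        ≡⟨ cong (ℚ._+ r) (ℚₚ.+-inverseʳ p) ⟩
  0ℚ ℚ.+ r               ≡⟨ ℚₚ.+-identityˡ r ⟩
  r                      ∎
  where open ≡-Reasoning

½r+½r : ∀ r → ½ ℚ.* r ℚ.+ ½ ℚ.* r ≡ r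
½r+½r r = trans (sym (ℚₚ.*-distribʳ-+ r ½ ½)) (ℚₚ.*-identityˡ r)

infixl 6 _+ᴿ_
_+ᴿ_ : ℝ → ℝ → ℝ
x +ᴿ y = record
  { _>ℚ_      = λ r → ∃₂ λ p q → x >ℚ p × y >ℚ q × r ≡ p ℚ.+ q
  ; inhabited = let (p , x>p) = ℝ.inhabited x ; (q , y>q) = ℝ.inhabited y in
                p ℚ.+ q , p , q , x>p , y>q , refl
  ; bounded   = let (p , x≯p) = ℝ.bounded x ; (q , y≯q) = ℝ.bounded y in
                p ℚ.+ q , λ (p′ , q′ , x>p′ , y>q′ , eq) →
                  ℚₚ.<-irrefl (sym eq) (ℚₚ.+-mono-< (>ℚ∧≯ℚ⇒< x x>p′ x≯p) (>ℚ∧≯ℚ⇒< y y>q′ y≯q))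
  ; downward  = λ { {r} r<s (p , q , x>p , y>q , refl) →
                  p , r ℚ.- p , x>p ,
                  ℝ.downward y (ℚₚ.≰⇒> λ q≤r-p → ℚ-<⇒≱ r<s
                    (subst (p ℚ.+ q ℚ.≤_) (p+[r-p] p r) (ℚₚ.+-monoʳ-≤ p q≤r-p))) y>q ,
                  sym (p+[r-p] p r) }
  ; open-cut  = λ { (p , q , x>p , y>q , refl) →
                  let (p′ , p<p′ , x>p′) = ℝ.open-cut x x>p in
                  p′ ℚ.+ q , ℚₚ.+-monoˡ-< q p<p′ , p′ , q , x>p′ , y>q , refl }
  }

infixr 7 _·_
_·_ : ℕ → ℝ → ℝ
zero  · x = ℕ→ℝ 0
suc n · x = x +ᴿ n · x

half : ℝ → ℝ
half x = record
  { _>ℚ_      = λ r → x >ℚ r ℚ.+ r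
  ; inhabited = let (r , x>r) = ℝ.inhabited x in ½ ℚ.* r , subst (x >ℚ_) (sym (½r+½r r)) x>r
  ; bounded   = let (r , x≯r) = ℝ.bounded x in ½ ℚ.* r , λ x>r → x≯r (subst (x >ℚ_) (½r+½r r) x>r)
  ; downward  = λ r<s → ℝ.downward x (ℚₚ.+-mono-< r<s r<s)
  ; open-cut  = λ {r} x>r+r →
                let (s , r+r<s , x>s) = ℝ.open-cut x x>r+r in
                ½ ℚ.* s ,
                ℚₚ.≰⇒> (λ ½s≤r → ℚ-<⇒≱ r+r<s (subst (ℚ._≤ r ℚ.+ r) (½r+½r s) (ℚₚ.+-mono-≤ ½s≤r ½s≤r))) ,
                subst (x >ℚ_) (sym (½r+½r s)) x>s
  }

ℕ→ℚ-mono-≤ : ∀ {m n} → m ℕ.≤ n → ℕ→ℚ m ℚ.≤ ℕ→ℚ n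
ℕ→ℚ-mono-≤ m≤n = *≤* (ℤₚ.*-monoʳ-≤-nonNeg (+ 1) (ℤ.+≤+ m≤n))

ℕ→ℚ-mono-< : ∀ {m n} → m ℕ.< n → ℕ→ℚ m ℚ.< ℕ→ℚ n
ℕ→ℚ-mono-< m<n = *<* (ℤₚ.*-monoʳ-<-pos (+ 1) (ℤ.+<+ m<n))

ℕ→ℚ-* : ∀ m n → ℕ→ℚ (m ℕ.* n) ≡ ℕ→ℚ m ℚ.* ℕ→ℚ n
ℕ→ℚ-* m n = ℚₚ.toℚᵘ-injective (ℚᵘₚ.≃-trans (ℚᵘ.*≡* (cong (ℤ._* (+ 1)) (ℤₚ.pos-* m n)))
              (ℚᵘₚ.≃-sym (ℚₚ.toℚᵘ-homo-* (ℕ→ℚ m) (ℕ→ℚ n))))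
  where
  import Data.Rational.Unnormalised.Base as ℚᵘ
  import Data.Rational.Unnormalised.Properties as ℚᵘₚ

ℕ→ℚ-^ : ∀ m n → ℕ→ℚ (m ℕ.^ n) ≡ ℕ→ℚ m ^ℚ n
ℕ→ℚ-^ m zero    = refl
ℕ→ℚ-^ m (suc n) = trans (ℕ→ℚ-* m (m ℕ.^ n)) (cong (ℕ→ℚ m ℚ.*_) (ℕ→ℚ-^ m n))

0≤ℕ→ℚ : ∀ n → 0ℚ ℚ.≤ ℕ→ℚ n
0≤ℕ→ℚ n = ℕ→ℚ-mono-≤ ℕ.z≤n

ℚ-*-mono-≤ : ∀ {p q r s} → 0ℚ ℚ.≤ p → 0ℚ ℚ.≤ s → p ℚ.≤ q → r ℚ.≤ s → p ℚ.* r ℚ.≤ q ℚ.* s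
ℚ-*-mono-≤ {p} {q} {r} {s} 0≤p 0≤s p≤q r≤s =
  ℚₚ.≤-trans (ℚₚ.*-monoˡ-≤-nonNeg p {{nonNegative 0≤p}} r≤s)
             (ℚₚ.*-monoʳ-≤-nonNeg s {{nonNegative 0≤s}} p≤q)

ℚ-^-nonneg : ∀ {p} → 0ℚ ℚ.≤ p → ∀ n → 0ℚ ℚ.≤ p ^ℚ n
ℚ-^-nonneg         0≤p zero    = ℕ→ℚ-mono-≤ ℕ.z≤n
ℚ-^-nonneg {p} 0≤p (suc n) =
  subst (ℚ._≤ p ℚ.* p ^ℚ n) (ℚₚ.*-zeroʳ p) (ℚₚ.*-monoˡ-≤-nonNeg p {{nonNegative 0≤p}} (ℚ-^-nonneg 0≤p n))

ℚ-^-mono-≤ : ∀ {p q} → 0ℚ ℚ.≤ p → p ℚ.≤ q → ∀ n → p ^ℚ n ℚ.≤ q ^ℚ n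
ℚ-^-mono-≤ 0≤p p≤q zero    = ℚₚ.≤-refl
ℚ-^-mono-≤ 0≤p p≤q (suc n) =
  ℚ-*-mono-≤ 0≤p (ℚ-^-nonneg (ℚₚ.≤-trans 0≤p p≤q) n) p≤q (ℚ-^-mono-≤ 0≤p p≤q n)

ℚ-^-mono-< : ∀ {p q} → 0ℚ ℚ.< p → p ℚ.< q → ∀ n → p ^ℚ suc n ℚ.< q ^ℚ suc n
ℚ-^-mono-< {p} {q} 0<p p<q n =
  ℚₚ.<-≤-trans (ℚₚ.*-monoˡ-<-pos (p ^ℚ n) {{positive (^-pos n)}} p<q)
               (ℚₚ.*-monoˡ-≤-nonNeg q {{nonNegative (ℚₚ.<⇒≤ (ℚₚ.<-trans 0<p p<q))}}
                  (ℚ-^-mono-≤ (ℚₚ.<⇒≤ 0<p) (ℚₚ.<⇒≤ p<q) n))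
  where
  ^-pos : ∀ n → 0ℚ ℚ.< p ^ℚ n
  ^-pos zero    = ℕ→ℚ-mono-< (ℕ.s≤s ℕ.z≤n)
  ^-pos (suc n) = subst (ℚ._< p ℚ.* p ^ℚ n) (ℚₚ.*-zeroʳ p) (ℚₚ.*-monoʳ-<-pos p {{positive 0<p}} (^-pos n))

√ : ℕ → ℝ
√ m = sup (λ t → 0ℚ ℚ.≤ t × t ℚ.* t ℚ.≤ ℕ→ℚ m)
          (0ℚ , ℚₚ.≤-refl , 0≤ℕ→ℚ m)
          (ℕ→ℚ (suc m) , λ t (0≤t , t²≤m) → ℚₚ.≮⇒≥ λ m+1<t →
             ℚ-<⇒≱ (ℚₚ.<-trans (ℕ→ℚ-mono-< ℕₚ.≤-refl) m+1<t)
               (ℚₚ.≤-trans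
                 (subst (ℚ._≤ t ℚ.* t) (ℚₚ.*-identityʳ t)
                   (ℚₚ.*-monoˡ-≤-nonNeg t {{nonNegative 0≤t}}
                     (ℚₚ.≤-trans (ℕ→ℚ-mono-≤ (ℕ.s≤s ℕ.z≤n)) (ℚₚ.<⇒≤ m+1<t))))
                 t²≤m))

-- m ^ᴿ x = sup { m ^ s ∣ s ∈ ℚ, 0 < s < x }, where t ≤ m ^ (a / b) is
-- t ^ b ≤ m ^ a.  This is the real power for x > 0 (with 0 ^ᴿ x = 0);
-- t ≡ 0ℚ only keeps the set inhabited when x ≤ 0.
RationalPowerBelow : ℕ → ℝ → ℚ → Set
RationalPowerBelow m x t =
  t ≡ 0ℚ ⊎ (0ℚ ℚ.≤ t × ∃ λ s → 0ℚ ℚ.< s × x >ℚ s × t ^ℚ ↧ₙ s ℚ.≤ ℕ→ℚ (m ℕ.^ ∣ ↥ s ∣))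

num≤num*den : ∀ s q → 0ℚ ℚ.< s → s ℚ.< q → ∣ ↥ s ∣ ℕ.≤ ∣ ↥ q ∣ ℕ.* ↧ₙ s
num≤num*den s@(mkℚ (+ a) b _) q@(mkℚ (+ c) d _) _ (*<* s<q) = begin
  a                ≤⟨ ℕₚ.m≤m*n a (suc d) ⟩
  a ℕ.* suc d      ≤⟨ ℤₚ.drop‿+≤+ (subst₂ ℤ._≤_ (sym (ℤₚ.pos-* a (suc d))) (sym (ℤₚ.pos-* c (suc b)))
                        (ℤₚ.<⇒≤ s<q)) ⟩
  c ℕ.* suc b      ∎
  where open ℕₚ.≤-Reasoning
num≤num*den (mkℚ (+ a) b _) (mkℚ (ℤ.-[1+ c ]) d _) _ (*<* s<q)
  with subst (ℤ._< ℤ.-[1+ c ] ℤ.* + suc b) (sym (ℤₚ.pos-* a (suc d))) s<q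
... | ()
num≤num*den (mkℚ (ℤ.-[1+ a ]) b _) q (*<* ()) _

power-bound : ∀ m x → ∃ λ b → ∀ t → RationalPowerBelow m x t → t ℚ.≤ b
power-bound m x = ℕ→ℚ M , bound
  where
  open ℕₚ.≤-Reasoning
  q = proj₁ (ℝ.bounded x)
  K = ∣ ↥ q ∣
  M = suc m ℕ.^ K

  M-bound : ∀ s → 0ℚ ℚ.< s → x >ℚ s → m ℕ.^ ∣ ↥ s ∣ ℕ.≤ M ℕ.^ ↧ₙ s
  M-bound s 0<s x>s = begin
    m ℕ.^ ∣ ↥ s ∣            ≤⟨ ℕₚ.^-monoˡ-≤ ∣ ↥ s ∣ (ℕₚ.n≤1+n m) ⟩
    suc m ℕ.^ ∣ ↥ s ∣        ≤⟨ ℕₚ.^-monoʳ-≤ (suc m) (num≤num*den s q 0<s (>ℚ∧≯ℚ⇒< x x>s (proj₂ (ℝ.bounded x)))) ⟩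
    suc m ℕ.^ (K ℕ.* ↧ₙ s)   ≡⟨ ℕₚ.^-*-assoc (suc m) K (↧ₙ s) ⟨
    M ℕ.^ ↧ₙ s               ∎

  bound : ∀ t → RationalPowerBelow m x t → t ℚ.≤ ℕ→ℚ M
  bound t (inj₁ refl) = 0≤ℕ→ℚ M
  bound t (inj₂ (0≤t , s , 0<s , x>s , t^b≤m^a)) = ℚₚ.≮⇒≥ λ M<t →
    ℚ-<⇒≱ (ℚ-^-mono-< (ℕ→ℚ-mono-< (ℕₚ.m^n>0 (suc m) K)) M<t (ℚ.denominator-1 s))
      (ℚₚ.≤-trans t^b≤m^a
        (subst (ℕ→ℚ (m ℕ.^ ∣ ↥ s ∣) ℚ.≤_) (ℕ→ℚ-^ M (↧ₙ s)) (ℕ→ℚ-mono-≤ (M-bound s 0<s x>s))))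

infixr 8 _^ᴿ_
_^ᴿ_ : ℕ → ℝ → ℝ
m ^ᴿ x = sup (RationalPowerBelow m x) (0ℚ , inj₁ refl) (power-bound m x)

IsCeiling : ℝ → ℕ → Set
IsCeiling x c = x ≤ᴿ ℕ→ℝ c × (∀ c′ → x ≤ᴿ ℕ→ℝ c′ → c ℕ.≤ c′)

------------------------------------------------------------------------
-- Key sets: a finite set of integer keys is its increasing enumeration,
-- each key being paired with its access count.

Entry : Set
Entry = ℤ × ℕ

record IsKeySet (xs : List Entry) : Set where
  field
    increasing : Linked (λ x y → proj₁ x ℤ.< proj₁ y) xs
    accessed   : All (λ x → 1 ℕ.≤ proj₂ x) xs

accesses : List Entry → ℕ
accesses xs = List.sum (List.map proj₂ xs)

interleave : ∀ {k} → Vec Entry k → Vec (List Entry) (suc k) → List Entry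
interleave []       (g ∷ [])     = g
interleave (r ∷ rs) (g ∷ gs) = g ++ r ∷ interleave rs gs

------------------------------------------------------------------------
-- GSAT D Aux xs: generic self-adjusting trees with degree function D for
-- the key set xs, whose nodes carry additional data in Aux m′, m′ being
-- the total access count of the node's subtree.
--
-- Since xs is increasing, xs ≡ interleave reps gaps says that the gaps are
-- the sets of keys before, strictly between and after the representatives.
-- The node has k = suc k′ ≥ 1 representatives; the access count stored in
-- it is accesses xs.

data GSAT (D : ℕ → ℝ) (Aux : ℕ → Set) : List Entry → Set where
  empty : GSAT D Aux []
  node  : ∀ {xs k′ c}
          (reps : Vec Entry (suc k′)) (gaps : Vec (List Entry) (suc (suc k′))) →
          xs ≡ interleave reps gaps →
          IsCeiling (D (accesses xs)) c → suc k′ ℕ.≤ c →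
          (aux : Aux (accesses xs)) →
          (children : ∀ j → GSAT D Aux (lookup gaps j)) →
          GSAT D Aux xs

-- m(Tⱼ) ≤ m / (D(m) + 1) is written without the division.
Ideal : ∀ {D Aux xs} → GSAT D Aux xs → Set
Ideal empty = ⊤
Ideal {D} {xs = xs} (node _ gaps _ _ _ _ children) =
  ∀ j → accesses (lookup gaps j) · (D (accesses xs) +ᴿ ℕ→ℝ 1) ≤ᴿ ℕ→ℝ (accesses xs)
      × Ideal (children j)

record InterpolationArray (α : ℝ) (m : ℕ) : Set where
  field
    size   : ℕ
    size≡  : IsCeiling (m ^ᴿ α) size
    ID     : Vec ℕ size

SAIT : ℝ → List Entry → Set
SAIT α = GSAT √ (InterpolationArray α)

-- BuildTime c T t: t is a possible construction time of T, all constants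
-- hidden in the O-bounds of the cost model being at most c.  At a node
-- with n′ keys below it, binary search on the n′ prefix sums takes
-- 1 + ⌊log₂ n′⌋ steps per representative.
data BuildTime (c : ℕ) {α : ℝ} : ∀ {xs} → SAIT α xs → ℕ → Set where
  empty : BuildTime c empty 0
  node  : ∀ {xs k′ d} {reps : Vec Entry (suc k′)} {gaps : Vec (List Entry) (suc (suc k′))}
            {split : xs ≡ interleave reps gaps}
            {ceil : IsCeiling (√ (accesses xs)) d} {k≤d : suc k′ ℕ.≤ d}
            {array : InterpolationArray α (accesses xs)}
            {children : ∀ j → SAIT α (lookup gaps j)}
            {t-node t-ID : ℕ} {ts : Vec ℕ (suc (suc k′))} →
          ℕ→ℝ t-node ≤ᴿ c · √ (accesses xs)
                        +ᴿ ℕ→ℝ (suc k′ ℕ.* (c ℕ.* suc ⌊log₂ List.length xs ⌋)) →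
          ℕ→ℝ t-ID ≤ᴿ c · accesses xs ^ᴿ α →
          (∀ j → BuildTime c (children j) (lookup ts j)) →
          BuildTime c (node reps gaps split ceil k≤d array children)
                      (t-node ℕ.+ t-ID ℕ.+ Vec.sum ts)

-- Memory c T s: s is a possible memory usage of T, in the same sense.
data Memory (c : ℕ) {α : ℝ} : ∀ {xs} → SAIT α xs → ℕ → Set where
  empty : Memory c empty 0
  node  : ∀ {xs k′ d} {reps : Vec Entry (suc k′)} {gaps : Vec (List Entry) (suc (suc k′))}
            {split : xs ≡ interleave reps gaps}
            {ceil : IsCeiling (√ (accesses xs)) d} {k≤d : suc k′ ℕ.≤ d}
            {array : InterpolationArray α (accesses xs)}
            {children : ∀ j → SAIT α (lookup gaps j)}
            {s-node s-ID : ℕ} {ss : Vec ℕ (suc (suc k′))} →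
          ℕ→ℝ s-node ≤ᴿ c · √ (accesses xs) →
          s-ID ℕ.≤ c ℕ.* InterpolationArray.size array →
          (∀ j → Memory c (children j) (lookup ss j)) →
          Memory c (node reps gaps split ceil k≤d array children)
                   (s-node ℕ.+ s-ID ℕ.+ Vec.sum ss)

{-# OPTIONS --safe #-}
-- Existence: put d = ⌈√ m⌉ and q = ⌊m / (d + 1)⌋ and cut off greedily maximal
-- prefixes with at most q accesses, each followed by a representative.  Every
-- such block uses at least q + 1 accesses and m < (d + 1) (q + 1), so after d
-- blocks at most q accesses remain.
--
-- Time: in an ideal tree a child with g accesses has 2 g ≤ m and g² ≤ m, so that
-- log₂ essentially halves from a node to its child.  Since α < 1, a node costs
-- only O(m / (1 + log₂ m)); induction on the tree then yields a total of at most
-- K m (3 - 2 / (1 + log₂ m)).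
--
-- Memory: as α ≥ ½, a node takes O(m′ ^ α).  This is O(m ^ α) at the root, and
-- O(m ^ (α / 2)) at each of the at most n other nodes because there m′² ≤ m.
module Submission where

open import Algebra.Bundles using (CommutativeRing)
open import Axiom.ExcludedMiddle using (ExcludedMiddle)
open import Data.Fin.Base using (zero; suc)
open import Data.Integer.Base as ℤ using (+_; ∣_∣)
import Data.Integer.Properties as ℤₚ
open import Data.List.Base using (List; []; _∷_; _++_; length)
open import Data.List.Properties using (length-++)
open import Data.List.Relation.Unary.All using (All; []; _∷_)
open import Data.List.Relation.Unary.All.Properties using (++⁻ˡ; ++⁻ʳ)
open import Data.Nat.Base as ℕ using (ℕ; zero; suc; _≤_; _<_; _*_; _^_; z≤n; s≤s; NonZero)
open import Data.Nat.DivMod using (_/_; m≡m%n+[m/n]*n; m%n<n; m/n*n≤m)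
open import Data.Nat.Induction using (<-rec)
open import Data.Nat.Logarithm using (⌊log₂_⌋; ⌊log₂⌋-mono-≤; ⌊log₂⌊n/2⌋⌋≡⌊log₂n⌋∸1; ⌊log₂[2*b]⌋≡1+⌊log₂b⌋; ⌊log₂[2^n]⌋≡n)
import Data.Nat.Properties as ℕₚ
open import Data.Nat.Tactic.RingSolver using (solve-∀)
open import Data.Product.Base using (_×_; _,_; proj₁; proj₂; ∃; Σ)
open import Data.Rational.Base as ℚ using (ℚ; mkℚ; 0ℚ; 1ℚ; ½; ↥_; ↧ₙ_; *≤*; *<*)
import Data.Rational.Properties as ℚₚ
import Data.Rational.Unnormalised.Base as ℚᵘ
import Data.Rational.Unnormalised.Properties as ℚᵘₚ
open import Data.Sum.Base using (_⊎_; inj₁; inj₂)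
open import Data.Unit.Base using (tt)
open import Data.Vec.Base as Vec using (Vec; []; _∷_; lookup)
open import Level using (0ℓ)
open import Relation.Binary.PropositionalEquality
open import Relation.Nullary using (¬_; yes; no; contradiction)
open import Defs

-- Logarithms

^-distribʳ-* : ∀ a b n → (a * b) ^ n ≡ a ^ n * b ^ n
^-distribʳ-* a b zero    = refl
^-distribʳ-* a b (suc n) = trans (cong (a * b *_) (^-distribʳ-* a b n)) (swap a b (a ^ n) (b ^ n))
  where
  swap : ∀ a b x y → a * b * (x * y) ≡ a * x * (b * y)
  swap = solve-∀

^-cancelˡ-≤ : ∀ {a b} n .{{_ : NonZero n}} → a ^ n ≤ b ^ n → a ≤ b
^-cancelˡ-≤ n aⁿ≤bⁿ = ℕₚ.≮⇒≥ λ b<a → ℕₚ.<⇒≱ (ℕₚ.^-monoˡ-< n b<a) aⁿ≤bⁿ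

2^⌊log₂n⌋≤n : ∀ n .{{_ : NonZero n}} → 2 ^ ⌊log₂ n ⌋ ≤ n
2^⌊log₂n⌋≤n n = <-rec (λ n → 1 ≤ n → 2 ^ ⌊log₂ n ⌋ ≤ n) step n (ℕₚ.n≢0⇒n>0 (ℕ.≢-nonZero⁻¹ n))
  where
  2*⌊n/2⌋≤n : ∀ n → 2 * ℕ.⌊ n /2⌋ ≤ n
  2*⌊n/2⌋≤n zero          = z≤n
  2*⌊n/2⌋≤n (suc zero)    = z≤n
  2*⌊n/2⌋≤n (suc (suc n)) = ℕₚ.≤-trans (ℕₚ.≤-reflexive (ℕₚ.*-suc 2 ℕ.⌊ n /2⌋)) (s≤s (s≤s (2*⌊n/2⌋≤n n)))

  step : ∀ n → (∀ {h} → h < n → 1 ≤ h → 2 ^ ⌊log₂ h ⌋ ≤ h) → 1 ≤ n → 2 ^ ⌊log₂ n ⌋ ≤ n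
  step (suc zero)        _  _ = ℕₚ.≤-refl
  step n@(suc (suc n-2)) ih _ = begin
    2 ^ ⌊log₂ n ⌋              ≡⟨ cong (2 ^_) (ℕₚ.m+[n∸m]≡n {1} (⌊log₂⌋-mono-≤ {2} {n} (s≤s (s≤s z≤n)))) ⟨
    2 * 2 ^ (⌊log₂ n ⌋ ℕ.∸ 1)  ≡⟨ cong (λ l → 2 * 2 ^ l) (⌊log₂⌊n/2⌋⌋≡⌊log₂n⌋∸1 n) ⟨
    2 * 2 ^ ⌊log₂ ℕ.⌊ n /2⌋ ⌋  ≤⟨ ℕₚ.*-monoʳ-≤ 2 (ih (ℕₚ.⌊n/2⌋<n (suc n-2)) (s≤s z≤n)) ⟩
    2 * ℕ.⌊ n /2⌋              ≤⟨ 2*⌊n/2⌋≤n n ⟩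
    n                          ∎
    where open ℕₚ.≤-Reasoning

n<2^n : ∀ n → n < 2 ^ n
n<2^n zero    = s≤s z≤n
n<2^n (suc n) = begin-strict
  suc n            ≤⟨ n<2^n n ⟩
  2 ^ n            <⟨ ℕₚ.m<m+n (2 ^ n) (ℕₚ.m^n>0 2 n) ⟩
  2 ^ n ℕ.+ 2 ^ n  ≡⟨ cong (2 ^ n ℕ.+_) (ℕₚ.+-identityʳ _) ⟨
  2 * 2 ^ n        ∎
  where open ℕₚ.≤-Reasoning

m<[1+m/n]*n : ∀ m n .{{_ : NonZero n}} → m < suc (m / n) * n
m<[1+m/n]*n m n = subst (_< suc (m / n) * n) (sym (m≡m%n+[m/n]*n m n)) (ℕₚ.+-monoˡ-< (m / n * n) (m%n<n m n))

-- With `q = l / b`, the base satisfies 1 + l ≤ (1 + q) b ≤ 2^q b, and the b-th power turns 2^q into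
-- 2^(q b) ≤ 2^l.
[1+l]^b≤b^b*2^l : ∀ l b .{{_ : NonZero b}} → suc l ^ b ≤ b ^ b * 2 ^ l
[1+l]^b≤b^b*2^l l b = begin
  suc l ^ b            ≤⟨ ℕₚ.^-monoˡ-≤ b (m<[1+m/n]*n l b) ⟩
  (suc q * b) ^ b      ≤⟨ ℕₚ.^-monoˡ-≤ b (ℕₚ.*-monoˡ-≤ b (n<2^n q)) ⟩
  (2 ^ q * b) ^ b      ≡⟨ cong (_^ b) (ℕₚ.*-comm (2 ^ q) b) ⟩
  (b * 2 ^ q) ^ b      ≡⟨ ^-distribʳ-* b (2 ^ q) b ⟩
  b ^ b * (2 ^ q) ^ b  ≡⟨ cong (b ^ b *_) (ℕₚ.^-*-assoc 2 q b) ⟩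
  b ^ b * 2 ^ (q * b)  ≤⟨ ℕₚ.*-monoʳ-≤ (b ^ b) (ℕₚ.^-monoʳ-≤ 2 (m/n*n≤m l b)) ⟩
  b ^ b * 2 ^ l        ∎
  where
  open ℕₚ.≤-Reasoning
  q = l / b

-- Any fixed power of the logarithm is at most linear. The case b = 4 serves √ m; for m^α, b is the
-- denominator of a rational between α and 1.
[1+log₂]^b≤b^b*m : ∀ m b .{{_ : NonZero m}} .{{_ : NonZero b}} → suc ⌊log₂ m ⌋ ^ b ≤ b ^ b * m
[1+log₂]^b≤b^b*m m b = ℕₚ.≤-trans ([1+l]^b≤b^b*2^l ⌊log₂ m ⌋ b) (ℕₚ.*-monoʳ-≤ (b ^ b) (2^⌊log₂n⌋≤n m))

1+log₂≤ : ∀ m .{{_ : NonZero m}} → suc ⌊log₂ m ⌋ ≤ m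
1+log₂≤ m = ℕₚ.≤-trans (n<2^n ⌊log₂ m ⌋) (2^⌊log₂n⌋≤n m)

-- Sums the two bounds log g + 1 ≤ log m and 2 log g ≤ log m.
log₂-child : ∀ {g m} .{{_ : NonZero g}} → 2 * g ≤ m → g * g ≤ m → 3 * ⌊log₂ g ⌋ ℕ.+ 1 ≤ 2 * ⌊log₂ m ⌋
log₂-child {g} {m} 2g≤m g²≤m = begin
  3 * lg ℕ.+ 1           ≡⟨ rearrange lg ⟩
  (1 ℕ.+ lg) ℕ.+ 2 * lg  ≤⟨ ℕₚ.+-mono-≤ 1+lg≤lm 2lg≤lm ⟩
  lm ℕ.+ lm              ≡⟨ cong (lm ℕ.+_) (ℕₚ.+-identityʳ lm) ⟨
  2 * lm                 ∎
  where
  open ℕₚ.≤-Reasoning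
  lg = ⌊log₂ g ⌋
  lm = ⌊log₂ m ⌋

  rearrange : ∀ x → 3 * x ℕ.+ 1 ≡ (1 ℕ.+ x) ℕ.+ 2 * x
  rearrange = solve-∀

  1+lg≤lm : 1 ℕ.+ lg ≤ lm
  1+lg≤lm = subst (_≤ lm) (⌊log₂[2*b]⌋≡1+⌊log₂b⌋ g) (⌊log₂⌋-mono-≤ 2g≤m)

  2lg≤lm : 2 * lg ≤ lm
  2lg≤lm = subst (_≤ lm) (⌊log₂[2^n]⌋≡n (2 * lg)) (⌊log₂⌋-mono-≤ (begin
    2 ^ (2 * lg)     ≡⟨ cong (λ z → 2 ^ (lg ℕ.+ z)) (ℕₚ.+-identityʳ lg) ⟩
    2 ^ (lg ℕ.+ lg)  ≡⟨ ℕₚ.^-distribˡ-+-* 2 lg lg ⟩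
    2 ^ lg * 2 ^ lg  ≤⟨ ℕₚ.*-mono-≤ (2^⌊log₂n⌋≤n g) (2^⌊log₂n⌋≤n g) ⟩
    g * g            ≤⟨ g²≤m ⟩
    m                ∎))

-- Arithmetic of cuts against natural numbers

ℕ→ℚ-+ : ∀ m n → ℕ→ℚ (m ℕ.+ n) ≡ ℕ→ℚ m ℚ.+ ℕ→ℚ n
ℕ→ℚ-+ m n = ℚₚ.toℚᵘ-injective (ℚᵘₚ.≃-trans
  (ℚᵘ.*≡* (cong (ℤ._* + 1) (sym (cong₂ ℤ._+_ (ℤₚ.*-identityʳ (+ m)) (ℤₚ.*-identityʳ (+ n))))))
  (ℚᵘₚ.≃-sym (ℚₚ.toℚᵘ-homo-+ (ℕ→ℚ m) (ℕ→ℚ n))))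

^ℚ-* : ∀ p m n → (p ^ℚ m) ^ℚ n ≡ p ^ℚ (m * n)
^ℚ-* = ^-assocʳ
  where
  open CommutativeRing ℚₚ.+-*-commutativeRing using (semiring)
  open import Algebra.Properties.Semiring.Exp semiring using (^-assocʳ)

-- Strict monotonicity of powers needs a positive base, but `q` may be 0. A rational `s` strictly
-- between `q` and `p` is positive and separates the powers.
^ℚ-cancel-≤ : ∀ {p q} n .{{_ : NonZero n}} → 0ℚ ℚ.≤ q → p ^ℚ n ℚ.≤ q ^ℚ n → p ℚ.≤ q
^ℚ-cancel-≤ {p} {q} (suc n) 0≤q pⁿ≤qⁿ = ℚₚ.≮⇒≥ λ q<p →
  let (s , q<s , s<p) = ℚₚ.<-dense q<p in
  ℚ-<⇒≱ (ℚ-^-mono-< (ℚₚ.≤-<-trans 0≤q q<s) s<p n)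
        (ℚₚ.≤-trans pⁿ≤qⁿ (ℚ-^-mono-≤ 0≤q (ℚₚ.<⇒≤ q<s) (suc n)))

≤ᴿ-trans : ∀ {x y z} → x ≤ᴿ y → y ≤ᴿ z → x ≤ᴿ z
≤ᴿ-trans x≤y y≤z r x>r = y≤z r (x≤y r x>r)

+ᴿ-mono-≤ : ∀ {x x′ y y′} → x ≤ᴿ x′ → y ≤ᴿ y′ → x +ᴿ y ≤ᴿ x′ +ᴿ y′
+ᴿ-mono-≤ x≤x′ y≤y′ _ (p , q , x>p , y>q , eq) = p , q , x≤x′ p x>p , y≤y′ q y>q , eq

·-monoʳ-≤ : ∀ n {x y} → x ≤ᴿ y → n · x ≤ᴿ n · y
·-monoʳ-≤ zero    x≤y = λ _ p → p
·-monoʳ-≤ (suc n) {x} {y} x≤y = +ᴿ-mono-≤ {x} {y} {n · x} {n · y} x≤y (·-monoʳ-≤ n {x} {y} x≤y)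

ℕ→ℝ-mono-≤ : ∀ {a b} → a ≤ b → ℕ→ℝ a ≤ᴿ ℕ→ℝ b
ℕ→ℝ-mono-≤ a≤b _ r<a = ℚₚ.<-≤-trans r<a (ℕ→ℚ-mono-≤ a≤b)

ℕ→ℝ-cancel-≤ : ∀ {a b} → ℕ→ℝ a ≤ᴿ ℕ→ℝ b → a ≤ b
ℕ→ℝ-cancel-≤ a≤b = ℕₚ.≮⇒≥ λ b<a → ℚₚ.<-irrefl refl (a≤b _ (ℕ→ℚ-mono-< b<a))

ℕ→ℝ-+-≥ : ∀ a b → ℕ→ℝ a +ᴿ ℕ→ℝ b ≤ᴿ ℕ→ℝ (a ℕ.+ b)
ℕ→ℝ-+-≥ a b _ (p , q , p<a , q<b , refl) =
  subst (p ℚ.+ q ℚ.<_) (sym (ℕ→ℚ-+ a b)) (ℚₚ.+-mono-< p<a q<b)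

-- Both summands have to be strict. A rational `s` between `r` and a + b shares out the slack: s - b
-- lies below a, and the rest r - (s - b) lies below b.
ℕ→ℝ-+-≤ : ∀ a b → ℕ→ℝ (a ℕ.+ b) ≤ᴿ ℕ→ℝ a +ᴿ ℕ→ℝ b
ℕ→ℝ-+-≤ a b r r<a+b =
  let (s , r<s , s<a+b) = ℚₚ.<-dense (subst (r ℚ.<_) (ℕ→ℚ-+ a b) r<a+b)
      B = ℕ→ℚ b
      A = ℕ→ℚ a
      p = s ℚ.- B
      q = r ℚ.- p
  in p , q
   , ℚₚ.≰⇒> (λ a≤p → ℚ-<⇒≱ s<a+b (subst₂ ℚ._≤_ (ℚₚ.+-comm B A) (p+[r-p] B s) (ℚₚ.+-monoʳ-≤ B a≤p)))
   , ℚₚ.≰⇒> (λ b≤q → ℚ-<⇒≱ r<s (subst₂ ℚ._≤_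
       (trans (ℚₚ.+-comm p B) (p+[r-p] B s)) (p+[r-p] p r) (ℚₚ.+-monoʳ-≤ p b≤q)))
   , sym (p+[r-p] p r)

ℕ→ℝ-*-≥ : ∀ n a → n · ℕ→ℝ a ≤ᴿ ℕ→ℝ (n * a)
ℕ→ℝ-*-≥ zero    a = λ _ p → p
ℕ→ℝ-*-≥ (suc n) a = ≤ᴿ-trans {suc n · ℕ→ℝ a} {ℕ→ℝ a +ᴿ ℕ→ℝ (n * a)} {ℕ→ℝ (suc n * a)}
  (+ᴿ-mono-≤ {ℕ→ℝ a} {ℕ→ℝ a} {n · ℕ→ℝ a} {ℕ→ℝ (n * a)} (λ _ p → p) (ℕ→ℝ-*-≥ n a))
  (ℕ→ℝ-+-≥ a (n * a))

ℕ→ℝ-*-≤ : ∀ n a → ℕ→ℝ (n * a) ≤ᴿ n · ℕ→ℝ a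
ℕ→ℝ-*-≤ zero    a = λ _ p → p
ℕ→ℝ-*-≤ (suc n) a = ≤ᴿ-trans {ℕ→ℝ (suc n * a)} {ℕ→ℝ a +ᴿ ℕ→ℝ (n * a)} {suc n · ℕ→ℝ a}
  (ℕ→ℝ-+-≤ a (n * a))
  (+ᴿ-mono-≤ {ℕ→ℝ a} {ℕ→ℝ a} {ℕ→ℝ (n * a)} {n · ℕ→ℝ a} (λ _ p → p) (ℕ→ℝ-*-≤ n a))

·-≤-ℕ : ∀ n {x a} → x ≤ᴿ ℕ→ℝ a → n · x ≤ᴿ ℕ→ℝ (n * a)
·-≤-ℕ n {x} {a} x≤a = ≤ᴿ-trans {n · x} {n · ℕ→ℝ a} {ℕ→ℝ (n * a)} (·-monoʳ-≤ n {x} {ℕ→ℝ a} x≤a) (ℕ→ℝ-*-≥ n a)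

·-≥-ℕ : ∀ n {x a} → ℕ→ℝ a ≤ᴿ x → ℕ→ℝ (n * a) ≤ᴿ n · x
·-≥-ℕ n {x} {a} a≤x = ≤ᴿ-trans {ℕ→ℝ (n * a)} {n · ℕ→ℝ a} {n · x} (ℕ→ℝ-*-≤ n a) (·-monoʳ-≤ n {ℕ→ℝ a} {x} a≤x)

+ᴿ-≤-ℕ : ∀ {x y a b} → x ≤ᴿ ℕ→ℝ a → y ≤ᴿ ℕ→ℝ b → x +ᴿ y ≤ᴿ ℕ→ℝ (a ℕ.+ b)
+ᴿ-≤-ℕ {x} {y} {a} {b} x≤a y≤b = ≤ᴿ-trans {x +ᴿ y} {ℕ→ℝ a +ᴿ ℕ→ℝ b} {ℕ→ℝ (a ℕ.+ b)}
  (+ᴿ-mono-≤ {x} {ℕ→ℝ a} {y} {ℕ→ℝ b} x≤a y≤b) (ℕ→ℝ-+-≥ a b)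

+ᴿ-≥-ℕ : ∀ {x y a b} → ℕ→ℝ a ≤ᴿ x → ℕ→ℝ b ≤ᴿ y → ℕ→ℝ (a ℕ.+ b) ≤ᴿ x +ᴿ y
+ᴿ-≥-ℕ {x} {y} {a} {b} a≤x b≤y = ≤ᴿ-trans {ℕ→ℝ (a ℕ.+ b)} {ℕ→ℝ a +ᴿ ℕ→ℝ b} {x +ᴿ y}
  (ℕ→ℝ-+-≤ a b) (+ᴿ-mono-≤ {ℕ→ℝ a} {x} {ℕ→ℝ b} {y} a≤x b≤y)

-- Square roots

√-≤ : ∀ {m e} → m ≤ e * e → √ m ≤ᴿ ℕ→ℝ e
√-≤ {m} {e} m≤e² r (t , (0≤t , t²≤m) , r<t) = ℚₚ.<-≤-trans r<t (ℚₚ.≮⇒≥ λ e<t → ℚ-<⇒≱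
  (subst₂ ℚ._<_ (cong (ℕ→ℚ e ℚ.*_) (ℚₚ.*-identityʳ (ℕ→ℚ e))) (cong (t ℚ.*_) (ℚₚ.*-identityʳ t))
    (squares e<t))
  (ℚₚ.≤-trans t²≤m (subst (ℕ→ℚ m ℚ.≤_) (ℕ→ℚ-* e e) (ℕ→ℚ-mono-≤ m≤e²))))
  where
  -- `e` may be 0, so strictness is obtained by contraposition from cancelling the square.
  squares : ℕ→ℚ e ℚ.< t → ℕ→ℚ e ^ℚ 2 ℚ.< t ^ℚ 2
  squares e<t = ℚₚ.≰⇒> λ t²≤e² → ℚ-<⇒≱ e<t (^ℚ-cancel-≤ 2 (0≤ℕ→ℚ e) t²≤e²)

√-≥ : ∀ {m e} → e * e ≤ m → ℕ→ℝ e ≤ᴿ √ m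
√-≥ {m} {e} e²≤m r r<e =
  ℕ→ℚ e , (0≤ℕ→ℚ e , subst (ℚ._≤ ℕ→ℚ m) (ℕ→ℚ-* e e) (ℕ→ℚ-mono-≤ e²≤m)) , r<e

⌈√⌉-pred : ∀ {m e} → IsCeiling (√ m) (suc e) → e * e < m
⌈√⌉-pred (_ , least) = ℕₚ.≰⇒> λ m≤e² → ℕₚ.<-irrefl refl (least _ (√-≤ m≤e²))

-- Real powers of natural numbers

-- The premise on exponents reads a / b ≤ c / d. Raising the bound on `t` to the power `d` gives
-- t^(b d) ≤ m^(a d) ≤ m^(c b), from which the exponent `b` is cancelled.
power-rescale : ∀ {m t} a b c d .{{_ : NonZero m}} .{{_ : NonZero b}} → a * d ≤ c * b →
  0ℚ ℚ.≤ t → t ^ℚ b ℚ.≤ ℕ→ℚ (m ^ a) → t ^ℚ d ℚ.≤ ℕ→ℚ (m ^ c)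
power-rescale {m} {t} a b c d ad≤cb 0≤t tᵇ≤mᵃ = ^ℚ-cancel-≤ b (0≤ℕ→ℚ (m ^ c)) (begin
  (t ^ℚ d) ^ℚ b      ≡⟨ trans (^ℚ-* t d b) (trans (cong (t ^ℚ_) (ℕₚ.*-comm d b)) (sym (^ℚ-* t b d))) ⟩
  (t ^ℚ b) ^ℚ d      ≤⟨ ℚ-^-mono-≤ (ℚ-^-nonneg 0≤t b) tᵇ≤mᵃ d ⟩
  ℕ→ℚ (m ^ a) ^ℚ d   ≡⟨ ℕ→ℚ-^ (m ^ a) d ⟨
  ℕ→ℚ ((m ^ a) ^ d)  ≡⟨ cong ℕ→ℚ (ℕₚ.^-*-assoc m a d) ⟩
  ℕ→ℚ (m ^ (a * d))  ≤⟨ ℕ→ℚ-mono-≤ (ℕₚ.^-monoʳ-≤ m ad≤cb) ⟩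
  ℕ→ℚ (m ^ (c * b))  ≡⟨ cong ℕ→ℚ (ℕₚ.^-*-assoc m c b) ⟨
  ℕ→ℚ ((m ^ c) ^ b)  ≡⟨ ℕ→ℚ-^ (m ^ c) b ⟩
  ℕ→ℚ (m ^ c) ^ℚ b   ∎)
  where open ℚₚ.≤-Reasoning

<⇒cross-≤ : ∀ s q → 0ℚ ℚ.< s → s ℚ.< q → ∣ ↥ s ∣ * ↧ₙ q ≤ ∣ ↥ q ∣ * ↧ₙ s
<⇒cross-≤ (mkℚ (+ a) b _) (mkℚ (+ c) d _) _ (*<* s<q) =
  ℤₚ.drop‿+≤+ (subst₂ ℤ._≤_ (sym (ℤₚ.pos-* a (suc d))) (sym (ℤₚ.pos-* c (suc b))) (ℤₚ.<⇒≤ s<q))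
<⇒cross-≤ (mkℚ (+ a) b _) (mkℚ (ℤ.-[1+ c ]) d _) _ (*<* s<q)
  with subst (ℤ._< ℤ.-[1+ c ] ℤ.* + suc b) (sym (ℤₚ.pos-* a (suc d))) s<q
... | ()
<⇒cross-≤ (mkℚ (ℤ.-[1+ a ]) b _) q (*<* ()) _

^ᴿ-≤ : ∀ {m x e} q .{{_ : NonZero m}} → ¬ x >ℚ q →
  m ^ ∣ ↥ q ∣ ≤ e ^ ↧ₙ q → m ^ᴿ x ≤ᴿ ℕ→ℝ e
^ᴿ-≤ {m} {x} {e} q x≯q mᴬ≤eᴮ r (t , t∈S , r<t) = ℚₚ.<-≤-trans r<t (bound t∈S)
  where
  bound : RationalPowerBelow m x t → t ℚ.≤ ℕ→ℚ e
  bound (inj₁ refl) = 0≤ℕ→ℚ e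
  bound (inj₂ (0≤t , s , 0<s , x>s , tᵇ≤mᵃ)) = ^ℚ-cancel-≤ (↧ₙ q) (0≤ℕ→ℚ e)
    (ℚₚ.≤-trans (power-rescale ∣ ↥ s ∣ (↧ₙ s) ∣ ↥ q ∣ (↧ₙ q) (<⇒cross-≤ s q 0<s (>ℚ∧≯ℚ⇒< x x>s x≯q)) 0≤t tᵇ≤mᵃ)
      (subst (ℕ→ℚ (m ^ ∣ ↥ q ∣) ℚ.≤_) (ℕ→ℚ-^ e (↧ₙ q)) (ℕ→ℚ-mono-≤ mᴬ≤eᴮ)))

-- The exponent is given as an unreduced fraction, whereas the cut speaks of its lowest terms;
-- `cross` equates the two.
^ᴿ-≥ : ∀ {m x w} a b-1 .{{_ : NonZero m}} .{{_ : NonZero a}} →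
  x >ℚ ℚ.fromℚᵘ (ℚᵘ.mkℚᵘ (+ a) b-1) → w ^ suc b-1 ≤ m ^ a → ℕ→ℝ w ≤ᴿ m ^ᴿ x
^ᴿ-≥ {m} {x} {w} a@(suc _) b-1 x>s wᵇ≤mᵃ r r<w =
  ℕ→ℚ w , inj₂ (0≤ℕ→ℚ w , s , 0<s , x>s ,
    power-rescale a (suc b-1) ∣ ↥ s ∣ (↧ₙ s) (ℕₚ.≤-reflexive cross) (0≤ℕ→ℚ w)
      (subst (ℚ._≤ ℕ→ℚ (m ^ a)) (ℕ→ℚ-^ w (suc b-1)) (ℕ→ℚ-mono-≤ wᵇ≤mᵃ))) , r<w
  where
  u = ℚᵘ.mkℚᵘ (+ a) b-1
  s = ℚ.fromℚᵘ u

  0<s : 0ℚ ℚ.< s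
  0<s = ℚₚ.toℚᵘ-cancel-< (ℚᵘₚ.<-respʳ-≃ (ℚᵘₚ.≃-sym (ℚₚ.toℚᵘ-fromℚᵘ u)) (ℚᵘ.*<* (ℤ.+<+ (s≤s z≤n))))

  cross : a * ↧ₙ s ≡ ∣ ↥ s ∣ * suc b-1
  cross with ℚₚ.toℚᵘ-fromℚᵘ u
  ... | ℚᵘ.*≡* eq = sym (begin
    ∣ ↥ s ∣ * suc b-1          ≡⟨ ℤₚ.abs-* (↥ s) (+ suc b-1) ⟨
    ∣ ↥ s ℤ.* + suc b-1 ∣      ≡⟨ cong ∣_∣ (trans (cong (ℤ._* + suc b-1) (sym (ℚₚ.↥ᵘ-toℚᵘ s))) eq) ⟩
    ∣ + a ℤ.* ℚᵘ.↧ ℚ.toℚᵘ s ∣  ≡⟨ cong (λ z → ∣ + a ℤ.* z ∣) (ℚₚ.↧ᵘ-toℚᵘ s) ⟩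
    ∣ + a ℤ.* ℚ.↧ s ∣          ≡⟨ ℤₚ.abs-* (+ a) (ℚ.↧ s) ⟩
    a * ↧ₙ s                   ∎)
    where open ≡-Reasoning

½*-cross : ∀ s → ∣ ↥ s ∣ * ↧ₙ (½ ℚ.* s) ≡ ∣ ↥ (½ ℚ.* s) ∣ * (↧ₙ s * 2)
½*-cross s@(mkℚ n d-1 _) with ℚₚ.toℚᵘ-homo-* ½ s
... | ℚᵘ.*≡* eq = begin
  ∣ n ∣ * ↧ₙ s′                           ≡⟨ cong (λ z → ∣ z ∣ * ↧ₙ s′) (ℤₚ.*-identityˡ n) ⟨
  ∣ + 1 ℤ.* n ∣ * ↧ₙ s′                   ≡⟨ ℤₚ.abs-* (+ 1 ℤ.* n) (ℚ.↧ s′) ⟨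
  ∣ (+ 1 ℤ.* n) ℤ.* ℚ.↧ s′ ∣              ≡⟨ cong (λ z → ∣ (+ 1 ℤ.* n) ℤ.* z ∣) (ℚₚ.↧ᵘ-toℚᵘ s′) ⟨
  ∣ (+ 1 ℤ.* n) ℤ.* ℚᵘ.↧ ℚ.toℚᵘ s′ ∣      ≡⟨ cong ∣_∣ eq ⟨
  ∣ ℚᵘ.↥ ℚ.toℚᵘ s′ ℤ.* + (2 * suc d-1) ∣  ≡⟨ cong (λ z → ∣ z ℤ.* + (2 * suc d-1) ∣) (ℚₚ.↥ᵘ-toℚᵘ s′) ⟩
  ∣ ↥ s′ ℤ.* + (2 * suc d-1) ∣            ≡⟨ ℤₚ.abs-* (↥ s′) (+ (2 * suc d-1)) ⟩
  ∣ ↥ s′ ∣ * (2 * suc d-1)                ≡⟨ cong (∣ ↥ s′ ∣ *_) (ℕₚ.*-comm 2 (suc d-1)) ⟩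
  ∣ ↥ s′ ∣ * (suc d-1 * 2)                ∎
  where
  open ≡-Reasoning
  s′ = ½ ℚ.* s

-- An exponent a / b below `x` is halved to lie below `half x`, and squaring the bound on `t` gives
-- t^(2 b) ≤ (m²)^a ≤ M^a. This yields m^α ≤ M^(α/2) for the nodes below the root.
^ᴿ-half : ∀ {m M} x .{{_ : NonZero M}} → m * m ≤ M → m ^ᴿ x ≤ᴿ M ^ᴿ half x
^ᴿ-half {m} {M} x m²≤M r (t , inj₁ t≡0 , r<t) = t , inj₁ t≡0 , r<t
^ᴿ-half {m} {M} x m²≤M r (t , inj₂ (0≤t , s , 0<s , x>s , tᵇ≤mᵃ) , r<t) =
  t , inj₂ (0≤t , s′ , 0<s′ , subst (x >ℚ_) (sym (½r+½r s)) x>s ,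
    power-rescale a (b * 2) ∣ ↥ s′ ∣ (↧ₙ s′) (ℕₚ.≤-reflexive (½*-cross s)) 0≤t t²ᵇ≤Mᵃ) , r<t
  where
  a = ∣ ↥ s ∣
  b = ↧ₙ s
  s′ = ½ ℚ.* s

  0<s′ : 0ℚ ℚ.< s′
  0<s′ = subst (ℚ._< s′) (ℚₚ.*-zeroʳ ½) (ℚₚ.*-monoʳ-<-pos ½ 0<s)

  t²ᵇ≤Mᵃ : t ^ℚ (b * 2) ℚ.≤ ℕ→ℚ (M ^ a)
  t²ᵇ≤Mᵃ = begin
    t ^ℚ (b * 2)       ≡⟨ ^ℚ-* t b 2 ⟨
    (t ^ℚ b) ^ℚ 2      ≤⟨ ℚ-^-mono-≤ (ℚ-^-nonneg 0≤t b) tᵇ≤mᵃ 2 ⟩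
    ℕ→ℚ (m ^ a) ^ℚ 2   ≡⟨ ℕ→ℚ-^ (m ^ a) 2 ⟨
    ℕ→ℚ ((m ^ a) ^ 2)  ≡⟨ cong ℕ→ℚ (trans (ℕₚ.^-*-assoc m a 2) (trans (cong (m ^_) (ℕₚ.*-comm a 2)) (sym (ℕₚ.^-*-assoc m 2 a)))) ⟩
    ℕ→ℚ ((m ^ 2) ^ a)  ≤⟨ ℕ→ℚ-mono-≤ (ℕₚ.^-monoˡ-≤ a (subst (_≤ M) (cong (m *_) (sym (ℕₚ.*-identityʳ m))) m²≤M)) ⟩
    ℕ→ℚ (M ^ a)        ∎
    where open ℚₚ.≤-Reasoning

0≤^ᴿ : ∀ m x → ℕ→ℝ 0 ≤ᴿ m ^ᴿ x
0≤^ᴿ m x r r<0 = 0ℚ , inj₁ refl , r<0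

1≤^ᴿ : ∀ {m x} a b-1 .{{_ : NonZero m}} .{{_ : NonZero a}} →
  x >ℚ ℚ.fromℚᵘ (ℚᵘ.mkℚᵘ (+ a) b-1) → ℕ→ℝ 1 ≤ᴿ m ^ᴿ x
1≤^ᴿ {m} {x} a b-1 x>s = ^ᴿ-≥ {m} {x} {1} a b-1 x>s (subst (_≤ m ^ a) (sym (ℕₚ.^-zeroˡ (suc b-1))) (ℕₚ.m^n>0 m a))

-- The exponent s = m / (2 (m + 1)) is so close to ½ that m ^ (½ - s) ≤ 2.
½-≤⇒half-√-≤-^ᴿ : ∀ {m x w} .{{_ : NonZero m}} → ℚ→ℝ ½ ≤ᴿ x →
  (2 * w) * (2 * w) ≤ m → ℕ→ℝ w ≤ᴿ m ^ᴿ x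
½-≤⇒half-√-≤-^ᴿ {m} {x} {w} ½≤x 4w²≤m = ^ᴿ-≥ {m} {x} {w} m (ℕ.pred (2 * suc m)) (½≤x _ s<½) w²ᵏ≤mᵐ
  where
  k = suc m
  u = ℚᵘ.mkℚᵘ (+ m) (ℕ.pred (2 * k))

  s<½ : ℚ.fromℚᵘ u ℚ.< ½
  s<½ = ℚₚ.toℚᵘ-cancel-< (ℚᵘₚ.<-respˡ-≃ (ℚᵘₚ.≃-sym (ℚₚ.toℚᵘ-fromℚᵘ u)) (ℚᵘ.*<*
    (subst₂ ℤ._<_ (ℤₚ.pos-* m 2) (ℤₚ.pos-* 1 (2 * k))
      (ℤ.+<+ (subst₂ _<_ (ℕₚ.*-comm 2 m) (sym (ℕₚ.*-identityˡ _)) (ℕₚ.*-monoʳ-< 2 (ℕₚ.n<1+n m)))))))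

  m≤4ᵏ : m ≤ 4 ^ k
  m≤4ᵏ = ℕₚ.≤-trans (ℕₚ.<⇒≤ (ℕₚ.<-trans (ℕₚ.n<1+n m) (n<2^n k))) (ℕₚ.^-monoˡ-≤ k {2} {4} (s≤s (s≤s z≤n)))

  w²ᵏ≤mᵐ : w ^ (2 * k) ≤ m ^ m
  w²ᵏ≤mᵐ = ℕₚ.*-cancelˡ-≤ (4 ^ k) {{ℕₚ.m^n≢0 4 k}} (begin
    4 ^ k * w ^ (2 * k)      ≡⟨ cong (4 ^ k *_) (ℕₚ.^-*-assoc w 2 k) ⟨
    4 ^ k * (w ^ 2) ^ k      ≡⟨ ^-distribʳ-* 4 (w ^ 2) k ⟨
    (4 * w ^ 2) ^ k          ≡⟨ cong (_^ k) (4w² w) ⟩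
    ((2 * w) * (2 * w)) ^ k  ≤⟨ ℕₚ.^-monoˡ-≤ k 4w²≤m ⟩
    m * m ^ m                ≤⟨ ℕₚ.*-monoˡ-≤ (m ^ m) m≤4ᵏ ⟩
    4 ^ k * m ^ m            ∎)
    where
    open ℕₚ.≤-Reasoning
    4w² : ∀ w → 4 * (w * (w * 1)) ≡ (2 * w) * (2 * w)
    4w² = solve-∀

-- Ceilings of cuts

-- Excluded middle decides whether `r` is in the cut. If not, then x ≤ r < e, so `e` would already
-- bound `x`, against minimality of `suc e`.
⌈⌉-pred : ExcludedMiddle 0ℓ → ∀ x {e} → IsCeiling x (suc e) → ℕ→ℝ e ≤ᴿ x
⌈⌉-pred em x {e} (_ , least) r r<e with em {x >ℚ r}
... | yes x>r = x>r
... | no  x≯r = contradiction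
  (least e λ s x>s → ℚₚ.<-trans (>ℚ∧≯ℚ⇒< x x>s x≯r) r<e) (ℕₚ.<-irrefl refl)

⌈⌉-mono : ∀ {x y a b} → x ≤ᴿ y → IsCeiling x a → IsCeiling y b → a ≤ b
⌈⌉-mono {x} {y} {b = b} x≤y (_ , least) (y≤b , _) = least b (≤ᴿ-trans {x} {y} {ℕ→ℝ b} x≤y y≤b)

≤ᴿ-ℕ-bound : ∀ x → ∃ λ n → x ≤ᴿ ℕ→ℝ n
≤ᴿ-ℕ-bound x = ∣ ↥ q ∣ , λ r x>r → ℚₚ.<-≤-trans (>ℚ∧≯ℚ⇒< x x>r x≯q) (p≤∣↥p∣ q)
  where
  q = proj₁ (ℝ.bounded x)
  x≯q = proj₂ (ℝ.bounded x)
  p≤∣↥p∣ : ∀ p → p ℚ.≤ ℕ→ℚ ∣ ↥ p ∣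
  p≤∣↥p∣ (mkℚ (+ a) b _) = *≤* (subst₂ ℤ._≤_ (ℤₚ.pos-* a 1) (ℤₚ.pos-* a (suc b))
    (ℤ.+≤+ (ℕₚ.*-monoʳ-≤ a (s≤s z≤n))))
  p≤∣↥p∣ (mkℚ (ℤ.-[1+ a ]) b _) = *≤* ℤ.-≤+

-- Linear search upwards from 0: `em` decides each candidate, and the known witness bounds the
-- search.
least-witness : ExcludedMiddle 0ℓ → (P : ℕ → Set) → ∀ n → P n → ∃ λ c → P c × (∀ c′ → P c′ → c ≤ c′)
least-witness em P zero    P0 = 0 , P0 , λ _ _ → z≤n
least-witness em P (suc n) Pn with em {P 0}
... | yes P0 = 0 , P0 , λ _ _ → z≤n
... | no ¬P0 = let (c , Pc , least) = least-witness em (λ k → P (suc k)) n Pn in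
  suc c , Pc , λ { zero P0 → contradiction P0 ¬P0 ; (suc c′) Pc′ → s≤s (least c′ Pc′) }

ceiling : ExcludedMiddle 0ℓ → ∀ x → ∃ (IsCeiling x)
ceiling em x = least-witness em (λ c → x ≤ᴿ ℕ→ℝ c) _ (proj₂ (≤ᴿ-ℕ-bound x))

-- Turns bounds by ceilings back into bounds by the real number itself. A ceiling e + 1 ≥ 2 is at
-- most 2 e, and `e` lies below `x`; for the ceiling 1 the premise 1 ≤ x supplies the floor.
⌈⌉≤2*floor : ExcludedMiddle 0ℓ → ∀ x {A} → ℕ→ℝ 1 ≤ᴿ x → IsCeiling x A → ∃ λ F → A ≤ 2 * F × ℕ→ℝ F ≤ᴿ x
⌈⌉≤2*floor em x {zero}        1≤x _ = 0 , z≤n , λ r r<0 → 1≤x r (ℚₚ.<-trans r<0 (ℕ→ℚ-mono-< (s≤s z≤n)))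
⌈⌉≤2*floor em x {suc zero}    1≤x _ = 1 , s≤s z≤n , 1≤x
⌈⌉≤2*floor em x {suc (suc e)} 1≤x ⌈x⌉ =
  suc e , s≤s (subst (suc e ≤_) (cong (e ℕ.+_) (sym (ℕₚ.+-identityʳ (suc e)))) (ℕₚ.m≤n+m (suc e) e)) , ⌈⌉-pred em x ⌈x⌉

-- Bounds on ⌈√ m⌉ and ⌈m ^ x⌉

⌊√⌋ : ∀ m → ∃ λ e → e * e ≤ m × m < suc e * suc e
⌊√⌋ zero    = 0 , z≤n , s≤s z≤n
⌊√⌋ (suc m) with ⌊√⌋ m
... | e , e²≤m , m<[1+e]² with suc m ℕₚ.<? suc e * suc e
...   | yes 1+m<[1+e]² = e , ℕₚ.m≤n⇒m≤1+n e²≤m , 1+m<[1+e]²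
...   | no  1+m≮[1+e]² = suc e , ℕₚ.≮⇒≥ 1+m≮[1+e]² ,
          ℕₚ.≤-<-trans m<[1+e]² (ℕₚ.*-mono-< (ℕₚ.n<1+n (suc e)) (ℕₚ.n<1+n (suc e)))

-- For e the integer root of m, idealness gives (e + 1) g ≤ m. Here e ≥ 1 because m ≥ 1, hence 2 g ≤
-- m; and m < (e + 1)² forces g ≤ e, hence g² ≤ m.
ideal-child : ∀ g {m} .{{_ : NonZero m}} → g · (√ m +ᴿ ℕ→ℝ 1) ≤ᴿ ℕ→ℝ m → 2 * g ≤ m × g * g ≤ m
ideal-child g {m} g[√m+1]≤m with ⌊√⌋ m
... | e , e²≤m , m<[1+e]² = ℕₚ.≤-trans (ℕₚ.*-monoˡ-≤ g 2≤e+1) [e+1]g≤m , ℕₚ.≤-trans (ℕₚ.*-mono-≤ g≤e g≤e) e²≤m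
  where
  [e+1]g≤m : (e ℕ.+ 1) * g ≤ m
  [e+1]g≤m = subst (_≤ m) (ℕₚ.*-comm g (e ℕ.+ 1)) (ℕ→ℝ-cancel-≤
    (≤ᴿ-trans {ℕ→ℝ (g * (e ℕ.+ 1))} {g · (√ m +ᴿ ℕ→ℝ 1)} {ℕ→ℝ m}
      (·-≥-ℕ g {√ m +ᴿ ℕ→ℝ 1} {e ℕ.+ 1} (+ᴿ-≥-ℕ {√ m} {ℕ→ℝ 1} {e} {1} (√-≥ e²≤m) (λ _ r<1 → r<1)))
      g[√m+1]≤m))

  2≤e+1 : 2 ≤ e ℕ.+ 1
  2≤e+1 = ℕₚ.+-monoˡ-≤ 1 (ℕₚ.n≢0⇒n>0 λ { refl → ℕ.≢-nonZero⁻¹ m (ℕₚ.n<1⇒n≡0 m<[1+e]²) })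

  g≤e : g ≤ e
  g≤e = ℕ.s≤s⁻¹ (ℕₚ.*-cancelˡ-< (suc e) g (suc e)
    (ℕₚ.≤-<-trans (subst (λ z → z * g ≤ m) (ℕₚ.+-comm e 1) [e+1]g≤m) m<[1+e]²))

⌈√⌉²≤4m : ∀ {m d} .{{_ : NonZero m}} → IsCeiling (√ m) d → d * d ≤ 4 * m
⌈√⌉²≤4m {m} {zero}          _   = z≤n
⌈√⌉²≤4m {m} {suc zero}      _   = ℕₚ.≤-trans (ℕₚ.n≢0⇒n>0 (ℕ.≢-nonZero⁻¹ m)) (ℕₚ.m≤n*m m 4)
⌈√⌉²≤4m {m} {suc e@(suc f)} ⌈√m⌉ = begin
  suc e * suc e      ≤⟨ ℕₚ.*-mono-≤ 1+e≤2e 1+e≤2e ⟩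
  (2 * e) * (2 * e)  ≡⟨ square e ⟩
  4 * (e * e)        ≤⟨ ℕₚ.*-monoʳ-≤ 4 (ℕₚ.<⇒≤ (⌈√⌉-pred ⌈√m⌉)) ⟩
  4 * m              ∎
  where
  open ℕₚ.≤-Reasoning
  square : ∀ e → (2 * e) * (2 * e) ≡ 4 * (e * e)
  square = solve-∀
  1+e≤2e : suc e ≤ 2 * e
  1+e≤2e = ℕₚ.≤-trans (ℕₚ.+-monoˡ-≤ e {1} {e} (s≤s z≤n)) (ℕₚ.≤-reflexive (cong (e ℕ.+_) (sym (ℕₚ.+-identityʳ e))))

-- After squaring, d² ≤ 4 m and L⁴ ≤ 4⁴ m multiply to 1024 m², which is (32 m)².
⌈√⌉*log² : ∀ {m d} .{{_ : NonZero m}} → IsCeiling (√ m) d →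
  let L = suc ⌊log₂ m ⌋ in d * (L * L) ≤ 32 * m
⌈√⌉*log² {m} {d} ⌈√m⌉ = ^-cancelˡ-≤ 2 (begin
  (d * (L * L)) ^ 2    ≡⟨ expand d L ⟩
  (d * d) * L ^ 4      ≤⟨ ℕₚ.*-mono-≤ (⌈√⌉²≤4m ⌈√m⌉) ([1+log₂]^b≤b^b*m m 4) ⟩
  (4 * m) * (256 * m)  ≡⟨ collect m ⟩
  (32 * m) ^ 2         ∎)
  where
  open ℕₚ.≤-Reasoning
  L = suc ⌊log₂ m ⌋
  expand : ∀ d L → (d * (L * L)) * ((d * (L * L)) * 1) ≡ (d * d) * (L * (L * (L * (L * 1))))
  expand = solve-∀
  collect : ∀ m → (4 * m) * (256 * m) ≡ (32 * m) * ((32 * m) * 1)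
  collect = solve-∀

-- This is where α < 1 enters. For s = e + 1, minimality gives e^B ≤ m^(B-1), which leaves one
-- factor m free to absorb L^B ≤ B^B m. The remaining single `L` is at most m, whence the constant B
-- + 1.
⌈^⌉*log : ∀ {m x s} q .{{_ : NonZero m}} → ¬ x >ℚ q → ∣ ↥ q ∣ < ↧ₙ q → IsCeiling (m ^ᴿ x) s →
  s * suc ⌊log₂ m ⌋ ≤ suc (↧ₙ q) * m
⌈^⌉*log         {s = zero}  q x≯q A<B _           = z≤n
⌈^⌉*log {m} {x} {s = suc e} q x≯q A<B (_ , least) = ℕₚ.+-mono-≤ (1+log₂≤ m) (^-cancelˡ-≤ B (begin
  (e * L) ^ B            ≡⟨ ^-distribʳ-* e L B ⟩
  e ^ B * L ^ B          ≤⟨ ℕₚ.*-mono-≤ eᴮ≤m^[B-1] ([1+log₂]^b≤b^b*m m B) ⟩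
  m ^ B-1 * (B ^ B * m)  ≡⟨ rearrange (m ^ B-1) (B ^ B) m ⟩
  B ^ B * m ^ B          ≡⟨ ^-distribʳ-* B m B ⟨
  (B * m) ^ B            ∎))
  where
  open ℕₚ.≤-Reasoning
  L = suc ⌊log₂ m ⌋
  B = ↧ₙ q
  B-1 = ℚ.denominator-1 q

  rearrange : ∀ x y m → x * (y * m) ≡ y * (m * x)
  rearrange = solve-∀

  eᴮ≤m^[B-1] : e ^ B ≤ m ^ B-1
  eᴮ≤m^[B-1] = begin
    e ^ B        ≤⟨ ℕₚ.<⇒≤ (ℕₚ.≰⇒> λ mᴬ≤eᴮ → ℕₚ.<-irrefl refl (least e (^ᴿ-≤ {m} {x} {e} q x≯q mᴬ≤eᴮ))) ⟩
    m ^ ∣ ↥ q ∣  ≤⟨ ℕₚ.^-monoʳ-≤ m (ℕ.s≤s⁻¹ A<B) ⟩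
    m ^ B-1      ∎

-- Key sets

Accessed : List Entry → Set
Accessed = All (λ x → 1 ≤ proj₂ x)

accesses-++ : ∀ xs ys → accesses (xs ++ ys) ≡ accesses xs ℕ.+ accesses ys
accesses-++ []       ys = refl
accesses-++ (x ∷ xs) ys = trans (cong (proj₂ x ℕ.+_) (accesses-++ xs ys))
                                (sym (ℕₚ.+-assoc (proj₂ x) (accesses xs) (accesses ys)))

length≤accesses : ∀ {xs} → Accessed xs → length xs ≤ accesses xs
length≤accesses []       = z≤n
length≤accesses (p ∷ ps) = ℕₚ.+-mono-≤ p (length≤accesses ps)

interleave-gap : ∀ {k} {P : Entry → Set} (reps : Vec Entry k) gaps → All P (interleave reps gaps) →
  ∀ j → All P (lookup gaps j)
interleave-gap []       (g ∷ []) ps zero = ps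
interleave-gap (r ∷ rs) (g ∷ gs) ps zero = ++⁻ˡ g ps
interleave-gap (r ∷ rs) (g ∷ gs) ps (suc j) with ++⁻ʳ g ps
... | _ ∷ ps′ = interleave-gap rs gs ps′ j

-- Adds up bounds over the children for a measure `f` that credits `e` to each representative. Time
-- takes accesses with e = 0; memory takes the number of keys with e = 1. The factors `a` and `b`
-- avoid division.
interleave-sum : ∀ (f : List Entry → ℕ) e → (∀ g r ys → f g ℕ.+ (e ℕ.+ f ys) ≤ f (g ++ r ∷ ys)) →
  ∀ {k} a b (reps : Vec Entry k) gaps ts → (∀ j → a * lookup ts j ≤ b * f (lookup gaps j)) →
  a * Vec.sum ts ℕ.+ b * (k * e) ≤ b * f (interleave reps gaps)
interleave-sum f e super a b [] (g ∷ []) (t ∷ []) bound = begin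
  a * (t ℕ.+ 0) ℕ.+ b * 0  ≡⟨ simplify a b t ⟩
  a * t                    ≤⟨ bound zero ⟩
  b * f g                  ∎
  where
  open ℕₚ.≤-Reasoning
  simplify : ∀ a b t → a * (t ℕ.+ 0) ℕ.+ b * 0 ≡ a * t
  simplify = solve-∀
interleave-sum f e super {suc k} a b (r ∷ rs) (g ∷ gs) (t ∷ ts) bound = begin
  a * (t ℕ.+ Vec.sum ts) ℕ.+ b * (e ℕ.+ k * e)            ≡⟨ rearrange a b t (Vec.sum ts) e (k * e) ⟩
  a * t ℕ.+ (b * e ℕ.+ (a * Vec.sum ts ℕ.+ b * (k * e)))  ≤⟨ ℕₚ.+-mono-≤ (bound zero) (ℕₚ.+-monoʳ-≤ (b * e)
                                                               (interleave-sum f e super a b rs gs ts (λ j → bound (suc j)))) ⟩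
  b * f g ℕ.+ (b * e ℕ.+ b * f (interleave rs gs))        ≡⟨ factor b (f g) e (f (interleave rs gs)) ⟩
  b * (f g ℕ.+ (e ℕ.+ f (interleave rs gs)))              ≤⟨ ℕₚ.*-monoʳ-≤ b (super g r (interleave rs gs)) ⟩
  b * f (g ++ r ∷ interleave rs gs)                       ∎
  where
  open ℕₚ.≤-Reasoning
  rearrange : ∀ a b t s e ke → a * (t ℕ.+ s) ℕ.+ b * (e ℕ.+ ke) ≡ a * t ℕ.+ (b * e ℕ.+ (a * s ℕ.+ b * ke))
  rearrange = solve-∀
  factor : ∀ b x e y → b * x ℕ.+ (b * e ℕ.+ b * y) ≡ b * (x ℕ.+ (e ℕ.+ y))
  factor = solve-∀

accesses-super : ∀ g r ys → accesses g ℕ.+ (0 ℕ.+ accesses ys) ≤ accesses (g ++ r ∷ ys)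
accesses-super g r ys = subst (accesses g ℕ.+ accesses ys ≤_) (sym (accesses-++ g (r ∷ ys)))
  (ℕₚ.+-monoʳ-≤ (accesses g) (ℕₚ.m≤n+m (accesses ys) (proj₂ r)))

length-super : ∀ (g : List Entry) r ys → length g ℕ.+ (1 ℕ.+ length ys) ≤ length (g ++ r ∷ ys)
length-super g r ys = ℕₚ.≤-reflexive (sym (length-++ g))

-- All `k` representatives lie outside any one gap. With k ≥ 1 this makes the construction of a tree
-- terminate.
gap-length : ∀ {k} (reps : Vec Entry k) gaps j → length (lookup gaps j) ℕ.+ k ≤ length (interleave reps gaps)
gap-length [] (g ∷ []) zero = ℕₚ.≤-reflexive (ℕₚ.+-identityʳ (length g))
gap-length {suc k} (r ∷ rs) (g ∷ gs) zero = ℕₚ.≤-trans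
  (ℕₚ.+-monoʳ-≤ (length g) (s≤s (ℕₚ.≤-trans (ℕₚ.m≤n+m k _) (gap-length rs gs zero))))
  (length-super g r (interleave rs gs))
gap-length {suc k} (r ∷ rs) (g ∷ gs) (suc j) = begin
  length (lookup gs j) ℕ.+ suc k                ≡⟨ ℕₚ.+-suc _ k ⟩
  suc (length (lookup gs j) ℕ.+ k)              ≤⟨ s≤s (gap-length rs gs j) ⟩
  suc (length (interleave rs gs))               ≤⟨ ℕₚ.m≤n+m _ (length g) ⟩
  length g ℕ.+ suc (length (interleave rs gs))  ≤⟨ length-super g r (interleave rs gs) ⟩
  length (g ++ r ∷ interleave rs gs)            ∎
  where open ℕₚ.≤-Reasoning

-- Existence of an ideal tree

-- The budget `q` shrinks by each entry that still fits; the first entry that does not fit becomes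
-- the representative `r`.
light-prefix : ∀ q xs → accesses xs ≤ q ⊎ ∃ λ g → ∃ λ r → ∃ λ ys →
  xs ≡ g ++ r ∷ ys × accesses g ≤ q × q < accesses g ℕ.+ proj₂ r
light-prefix q [] = inj₁ z≤n
light-prefix q (x ∷ xs) with proj₂ x ℕₚ.≤? q
... | no  a≰q = inj₂ ([] , x , xs , refl , z≤n , ℕₚ.≰⇒> a≰q)
... | yes a≤q with light-prefix (q ℕ.∸ proj₂ x) xs
...   | inj₁ light = inj₁ (subst (accesses (x ∷ xs) ≤_) (ℕₚ.m+[n∸m]≡n a≤q) (ℕₚ.+-monoʳ-≤ (proj₂ x) light))
...   | inj₂ (g , r , ys , refl , light , heavy) = inj₂ (x ∷ g , r , ys , refl ,
          subst (accesses (x ∷ g) ≤_) (ℕₚ.m+[n∸m]≡n a≤q) (ℕₚ.+-monoʳ-≤ (proj₂ x) light) ,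
          subst₂ _<_ (ℕₚ.m+[n∸m]≡n a≤q) (sym (ℕₚ.+-assoc (proj₂ x) (accesses g) (proj₂ r)))
            (ℕₚ.+-monoʳ-< (proj₂ x) heavy))

record LightSplit (q d : ℕ) (xs : List Entry) : Set where
  constructor lightSplit
  field
    {k}   : ℕ
    k≤d   : k ≤ d
    reps  : Vec Entry k
    gaps  : Vec (List Entry) (suc k)
    split : xs ≡ interleave reps gaps
    light : ∀ j → accesses (lookup gaps j) ≤ q

light-split : ∀ q d xs → accesses xs < suc d * suc q → LightSplit q d xs
light-split q zero xs m< = lightSplit z≤n [] (xs ∷ []) refl
  λ { zero → ℕ.s≤s⁻¹ (subst (accesses xs <_) (ℕₚ.+-identityʳ (suc q)) m<) }
light-split q (suc d) xs m< with light-prefix q xs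
... | inj₁ light = lightSplit z≤n [] (xs ∷ []) refl λ { zero → light }
... | inj₂ (g , r , ys , refl , light , heavy) =
  -- The removed block has at least q + 1 accesses, so one factor is used up and the invariant
  -- passes to `ys` with `d`.
  let lightSplit k≤d reps gaps split lights = light-split q d ys (ℕₚ.+-cancelˡ-< (suc q) _ _ (begin-strict
        suc q ℕ.+ accesses ys                   ≤⟨ ℕₚ.+-monoˡ-≤ (accesses ys) heavy ⟩
        accesses g ℕ.+ proj₂ r ℕ.+ accesses ys  ≡⟨ ℕₚ.+-assoc (accesses g) (proj₂ r) (accesses ys) ⟩
        accesses g ℕ.+ accesses (r ∷ ys)        ≡⟨ accesses-++ g (r ∷ ys) ⟨
        accesses (g ++ r ∷ ys)                  <⟨ m< ⟩
        suc q ℕ.+ suc d * suc q                 ∎))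
  in lightSplit (s≤s k≤d) (r ∷ reps) (g ∷ gaps) (cong (λ zs → g ++ r ∷ zs) split)
       λ { zero → light ; (suc j) → lights j }
  where open ℕₚ.≤-Reasoning

ideal-light : ∀ {m d g} → √ m ≤ᴿ ℕ→ℝ d → g ≤ m / suc d → g · (√ m +ᴿ ℕ→ℝ 1) ≤ᴿ ℕ→ℝ m
ideal-light {m} {d} {g} √m≤d g≤q = ≤ᴿ-trans {g · (√ m +ᴿ ℕ→ℝ 1)} {ℕ→ℝ (g * (d ℕ.+ 1))} {ℕ→ℝ m}
  (·-≤-ℕ g {√ m +ᴿ ℕ→ℝ 1} {d ℕ.+ 1} (+ᴿ-≤-ℕ {√ m} {ℕ→ℝ 1} {d} {1} √m≤d (λ _ r<1 → r<1)))
  (ℕ→ℝ-mono-≤ (begin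
    g * (d ℕ.+ 1)        ≡⟨ cong (g *_) (ℕₚ.+-comm d 1) ⟩
    g * suc d            ≤⟨ ℕₚ.*-monoˡ-≤ (suc d) g≤q ⟩
    (m / suc d) * suc d  ≤⟨ m/n*n≤m m (suc d) ⟩
    m                    ∎))
  where open ℕₚ.≤-Reasoning

-- Excludes a split without representatives, whose only gap would hold all m accesses. As √ m ≥ 1,
-- also d ≥ 1, so m / (d + 1) is smaller than m.
not-light : ∀ {m d} → 1 ≤ m → √ m ≤ᴿ ℕ→ℝ d → ¬ m ≤ m / suc d
not-light {m} {d} 1≤m √m≤d m≤q = ℕₚ.<⇒≱ m<m*[1+d] (begin
  m * suc d            ≤⟨ ℕₚ.*-monoˡ-≤ (suc d) m≤q ⟩
  (m / suc d) * suc d  ≤⟨ m/n*n≤m m (suc d) ⟩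
  m                    ∎)
  where
  open ℕₚ.≤-Reasoning
  1≤d : 1 ≤ d
  1≤d = ℕ→ℝ-cancel-≤ (≤ᴿ-trans {ℕ→ℝ 1} {√ m} {ℕ→ℝ d} (√-≥ {m} {1} 1≤m) √m≤d)
  m<m*[1+d] : m < m * suc d
  m<m*[1+d] = ℕₚ.m<m*n m (suc d) {{ℕ.>-nonZero 1≤m}} (s≤s 1≤d)

-- `N` bounds the number of keys and makes the recursion structural.
ideal-SAIT : ExcludedMiddle 0ℓ → ∀ α N xs → length xs ≤ N → Accessed xs → Σ (SAIT α xs) Ideal
ideal-SAIT em α N       []          _     _   = empty , tt
ideal-SAIT em α (suc N) xs@(x ∷ xs′) len≤N acc
  with ceiling em (√ (accesses xs)) | ceiling em (accesses xs ^ᴿ α)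
... | d , ⌈√m⌉ | s , ⌈mᵅ⌉ with light-split (accesses xs / suc d) d xs
      (subst (accesses xs <_) (ℕₚ.*-comm (suc (accesses xs / suc d)) (suc d)) (m<[1+m/n]*n (accesses xs) (suc d)))
...   | lightSplit {zero}  k≤d [] (g ∷ []) split light = contradiction
          (subst (λ ys → accesses ys ≤ _) (sym split) (light zero))
          (not-light (ℕₚ.≤-trans (s≤s z≤n) (length≤accesses acc)) (proj₁ ⌈√m⌉))
...   | lightSplit {suc k} k≤d reps gaps split light =
          node reps gaps split ⌈√m⌉ k≤d array (λ j → proj₁ (child j)) ,
          (λ j → ideal-light (proj₁ ⌈√m⌉) (light j) , proj₂ (child j))
  where
  array : InterpolationArray α (accesses xs)
  -- Zeros are the default contents; the size is the ceiling found above.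
  array = record { size = s ; size≡ = ⌈mᵅ⌉ ; ID = Vec.replicate s 0 }

  shorter : ∀ j → length (lookup gaps j) ≤ N
  shorter j = ℕ.s≤s⁻¹ (begin
    suc (length (lookup gaps j))        ≤⟨ s≤s (ℕₚ.m≤m+n _ k) ⟩
    suc (length (lookup gaps j) ℕ.+ k)  ≡⟨ ℕₚ.+-suc _ k ⟨
    length (lookup gaps j) ℕ.+ suc k    ≤⟨ gap-length reps gaps j ⟩
    length (interleave reps gaps)       ≡⟨ cong length split ⟨
    length xs                           ≤⟨ len≤N ⟩
    suc N                               ∎)
    where open ℕₚ.≤-Reasoning

  child : ∀ j → Σ (SAIT α (lookup gaps j)) Ideal
  child j = ideal-SAIT em α N (lookup gaps j) (shorter j)
    (interleave-gap reps gaps (subst Accessed split acc) j)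

-- Construction time

interleave-accesses>0 : ∀ {k} (reps : Vec Entry (suc k)) gaps → Accessed (interleave reps gaps) →
  0 < accesses (interleave reps gaps)
interleave-accesses>0 {k} reps gaps acc = ℕₚ.≤-trans
  (ℕₚ.≤-trans (s≤s z≤n) (ℕₚ.m+n≤o⇒n≤o (length (lookup gaps zero)) (gap-length reps gaps zero)))
  (length≤accesses acc)

-- The child's own bound K g (3 - 2 / (1 + log g)) becomes K g (3 - 3 / (1 + l)) in terms of the
-- parent's logarithm `l`. Compared with 3 - 2 / (1 + l), this leaves K m / (1 + l) for the parent
-- node itself.
child-time : ∀ K g l t → suc ⌊log₂ g ⌋ * t ≤ K * g * (3 * ⌊log₂ g ⌋ ℕ.+ 1) →
  (.{{_ : NonZero g}} → 3 * ⌊log₂ g ⌋ ℕ.+ 1 ≤ 2 * l) → suc l * t ≤ 3 * l * K * g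
child-time K zero l t IH _ = begin
  suc l * t      ≡⟨ cong (suc l *_) t≡0 ⟩
  suc l * 0      ≡⟨ ℕₚ.*-zeroʳ (suc l) ⟩
  0              ≤⟨ z≤n ⟩
  3 * l * K * 0  ∎
  where
  open ℕₚ.≤-Reasoning
  -- For an empty gap the right side of `IH` vanishes and the left side is `t`.
  t≡0 : t ≡ 0
  t≡0 = ℕₚ.n≤0⇒n≡0 (subst₂ _≤_ (ℕₚ.+-identityʳ t) (cong (_* 1) (ℕₚ.*-zeroʳ K)) IH)
child-time K g@(suc _) l t IH 3lg+1≤2l = ℕₚ.*-cancelˡ-≤ (suc lg) (begin
  suc lg * (suc l * t)                             ≡⟨ swap (suc lg) (suc l) t ⟩
  suc l * (suc lg * t)                             ≤⟨ ℕₚ.*-monoʳ-≤ (suc l) IH ⟩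
  suc l * (K * g * (3 * lg ℕ.+ 1))                 ≡⟨ expand l (K * g) lg ⟩
  K * g * (l * (3 * lg ℕ.+ 1) ℕ.+ (3 * lg ℕ.+ 1))  ≤⟨ ℕₚ.*-monoʳ-≤ (K * g) (ℕₚ.+-monoʳ-≤ (l * (3 * lg ℕ.+ 1)) 3lg+1≤2l) ⟩
  K * g * (l * (3 * lg ℕ.+ 1) ℕ.+ 2 * l)           ≡⟨ collect l K g lg ⟩
  suc lg * (3 * l * K * g)                         ∎)
  where
  open ℕₚ.≤-Reasoning
  lg = ⌊log₂ g ⌋
  swap : ∀ a b t → a * (b * t) ≡ b * (a * t)
  swap = solve-∀
  expand : ∀ l x y → suc l * (x * (3 * y ℕ.+ 1)) ≡ x * (l * (3 * y ℕ.+ 1) ℕ.+ (3 * y ℕ.+ 1))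
  expand = solve-∀
  collect : ∀ l K g y → K * g * (l * (3 * y ℕ.+ 1) ℕ.+ 2 * l) ≡ suc y * (3 * l * K * g)
  collect = solve-∀

-- The part 64 c = 2 c · 32 pays for representatives and binary searches, the other part for the
-- interpolation array, each via its ceiling-times-logarithm bound.
timeConstant : ℚ → ℕ → ℕ
timeConstant q c = 64 * c ℕ.+ c * suc (↧ₙ q)

module _ {α : ℝ} (q : ℚ) (α≯q : ¬ α >ℚ q) (q<1 : ∣ ↥ q ∣ < ↧ₙ q) (c : ℕ) where

  private K = timeConstant q c

  node-time : ∀ {m n k d s t-node t-ID} .{{_ : NonZero m}} → n ≤ m → k ≤ d →
    IsCeiling (√ m) d → IsCeiling (m ^ᴿ α) s →
    ℕ→ℝ t-node ≤ᴿ c · √ m +ᴿ ℕ→ℝ (k * (c * suc ⌊log₂ n ⌋)) → ℕ→ℝ t-ID ≤ᴿ c · m ^ᴿ α →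
    suc ⌊log₂ m ⌋ * (t-node ℕ.+ t-ID) ≤ K * m
  node-time {m} {n} {k} {d} {s} {t-node} {t-ID} n≤m k≤d ⌈√m⌉ ⌈mᵅ⌉ node≤ ID≤ = begin
    L * (t-node ℕ.+ t-ID)                      ≤⟨ ℕₚ.*-monoʳ-≤ L (ℕₚ.+-mono-≤ node≤′ ID≤′) ⟩
    L * (c * d ℕ.+ k * (c * Lₙ) ℕ.+ c * s)     ≤⟨ ℕₚ.*-monoʳ-≤ L (ℕₚ.+-monoˡ-≤ (c * s) (ℕₚ.+-mono-≤
                                                    -- Inflating c d by a factor `L` lets it share
                                                    -- the bound on d L² with the binary searches.
                                                    (ℕₚ.m≤m*n (c * d) L)
                                                    (ℕₚ.*-mono-≤ k≤d (ℕₚ.*-monoʳ-≤ c (s≤s (⌊log₂⌋-mono-≤ n≤m)))))) ⟩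
    L * (c * d * L ℕ.+ d * (c * L) ℕ.+ c * s)  ≡⟨ collect L c d s ⟩
    2 * c * (d * (L * L)) ℕ.+ c * (s * L)      ≤⟨ ℕₚ.+-mono-≤ (ℕₚ.*-monoʳ-≤ (2 * c) (⌈√⌉*log² ⌈√m⌉))
                                                              (ℕₚ.*-monoʳ-≤ c (⌈^⌉*log {m} {α} q α≯q q<1 ⌈mᵅ⌉)) ⟩
    2 * c * (32 * m) ℕ.+ c * (suc (↧ₙ q) * m)  ≡⟨ factor c m (suc (↧ₙ q)) ⟩
    K * m                                      ∎
    where
    open ℕₚ.≤-Reasoning
    L = suc ⌊log₂ m ⌋
    Lₙ = suc ⌊log₂ n ⌋
    collect : ∀ L c d s → L * (c * d * L ℕ.+ d * (c * L) ℕ.+ c * s) ≡ 2 * c * (d * (L * L)) ℕ.+ c * (s * L)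
    collect = solve-∀
    factor : ∀ c m b → 2 * c * (32 * m) ℕ.+ c * (b * m) ≡ (64 * c ℕ.+ c * b) * m
    factor = solve-∀
    node≤′ : t-node ≤ c * d ℕ.+ k * (c * Lₙ)
    node≤′ = ℕ→ℝ-cancel-≤ (≤ᴿ-trans {ℕ→ℝ t-node} {c · √ m +ᴿ ℕ→ℝ (k * (c * Lₙ))} {ℕ→ℝ (c * d ℕ.+ k * (c * Lₙ))} node≤
      (+ᴿ-≤-ℕ {c · √ m} {ℕ→ℝ (k * (c * Lₙ))} {c * d} {k * (c * Lₙ)} (·-≤-ℕ c {√ m} {d} (proj₁ ⌈√m⌉)) (λ _ p → p)))
    ID≤′ : t-ID ≤ c * s
    ID≤′ = ℕ→ℝ-cancel-≤ (≤ᴿ-trans {ℕ→ℝ t-ID} {c · m ^ᴿ α} {ℕ→ℝ (c * s)} ID≤ (·-≤-ℕ c {m ^ᴿ α} {s} (proj₁ ⌈mᵅ⌉)))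

  -- Equivalently t ≤ K m (3 - 2 / (1 + log₂ m)).
  build-time-invariant : ∀ {xs} {T : SAIT α xs} {t} → Accessed xs → Ideal T → BuildTime c T t →
    suc ⌊log₂ accesses xs ⌋ * t ≤ K * accesses xs * (3 * ⌊log₂ accesses xs ⌋ ℕ.+ 1)
  build-time-invariant _ _ empty = z≤n
  build-time-invariant acc ideal
    (node {k′ = k′} {reps = reps} {gaps} {refl} {⌈√m⌉} {k≤d} {array} {_} {t-node} {t-ID} {ts} node≤ ID≤ times) = begin
    suc l * (t-node ℕ.+ t-ID ℕ.+ Vec.sum ts)          ≡⟨ ℕₚ.*-distribˡ-+ (suc l) (t-node ℕ.+ t-ID) (Vec.sum ts) ⟩
    suc l * (t-node ℕ.+ t-ID) ℕ.+ suc l * Vec.sum ts  ≤⟨ ℕₚ.+-mono-≤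
                                                           (node-time (length≤accesses acc) k≤d ⌈√m⌉ (InterpolationArray.size≡ array) node≤ ID≤)
                                                           (ℕₚ.≤-trans (ℕₚ.m≤m+n _ _)
                                                             (interleave-sum accesses 0 accesses-super (suc l) (3 * l * K) reps gaps ts child)) ⟩
    K * m ℕ.+ 3 * l * K * m                           ≡⟨ collect K m l ⟩
    K * m * (3 * l ℕ.+ 1)                             ∎
    where
    open ℕₚ.≤-Reasoning
    m = accesses (interleave reps gaps)
    l = ⌊log₂ m ⌋
    instance
      m≢0 : NonZero m
      m≢0 = ℕ.>-nonZero (interleave-accesses>0 reps gaps acc)
    collect : ∀ K m l → K * m ℕ.+ 3 * l * K * m ≡ K * m * (3 * l ℕ.+ 1)
    collect = solve-∀
    child : ∀ j → suc l * lookup ts j ≤ 3 * l * K * accesses (lookup gaps j)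
    child j = child-time K (accesses (lookup gaps j)) l (lookup ts j)
      (build-time-invariant (interleave-gap reps gaps acc j) (proj₂ (ideal j)) (times j))
      (let (2g≤m , g²≤m) = ideal-child (accesses (lookup gaps j)) (proj₁ (ideal j)) in log₂-child 2g≤m g²≤m)

  build-time : ∀ {xs} {T : SAIT α xs} {t} → Accessed xs → Ideal T → BuildTime c T t → t ≤ 3 * K * accesses xs
  build-time {xs} {t = t} acc ideal time = ℕₚ.*-cancelˡ-≤ (suc l) (begin
    suc l * t              ≤⟨ build-time-invariant acc ideal time ⟩
    -- Rounding 1 up to 3 lets the factor `suc l` split off and cancel.
    K * m * (3 * l ℕ.+ 1)  ≤⟨ ℕₚ.*-monoʳ-≤ (K * m) (ℕₚ.+-monoʳ-≤ (3 * l) {1} {3} (s≤s z≤n)) ⟩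
    K * m * (3 * l ℕ.+ 3)  ≡⟨ collect K m l ⟩
    suc l * (3 * K * m)    ∎)
    where
    open ℕₚ.≤-Reasoning
    m = accesses xs
    l = ⌊log₂ m ⌋
    collect : ∀ K m l → K * m * (3 * l ℕ.+ 3) ≡ suc l * (3 * K * m)
    collect = solve-∀

-- Memory

-- A positive point strictly below ½. It puts the exponent 1/4 below α and, as 1/8 + 1/8 = 1/4, the
-- exponent 1/8 below `half α`.
¼ : ℚ
¼ = ½ ℚ.* ½

½≤ᴿ⇒>¼ : ∀ {x} → ℚ→ℝ ½ ≤ᴿ x → x >ℚ ¼
½≤ᴿ⇒>¼ ½≤x = ½≤x ¼ (*<* (ℤ.+<+ (s≤s (s≤s (s≤s z≤n)))))

module _ {α : ℝ} (½≤α : ℚ→ℝ ½ ≤ᴿ α) (c : ℕ) where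

  1≤mᵅ : ∀ m .{{_ : NonZero m}} → ℕ→ℝ 1 ≤ᴿ m ^ᴿ α
  1≤mᵅ m = 1≤^ᴿ {m} {α} 1 3 (½≤ᴿ⇒>¼ {α} ½≤α)

  1≤mᵅᐟ² : ∀ m .{{_ : NonZero m}} → ℕ→ℝ 1 ≤ᴿ m ^ᴿ half α
  1≤mᵅᐟ² m = 1≤^ᴿ {m} {half α} 1 7 (½≤ᴿ⇒>¼ {α} ½≤α)

  -- For d = e + 1 and w = ⌊e / 2⌋, (2 w)² ≤ e² < m gives w ≤ m^α ≤ s. With 1 ≤ s, d ≤ 2 (w + 1) ≤ 4
  -- s.
  ⌈√⌉≤4⌈^⌉ : ∀ {m d s} .{{_ : NonZero m}} → IsCeiling (√ m) d → IsCeiling (m ^ᴿ α) s → d ≤ 4 * s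
  ⌈√⌉≤4⌈^⌉         {d = zero}      _    _          = z≤n
  ⌈√⌉≤4⌈^⌉ {m} {d = suc e} {s} ⌈√m⌉ (mᵅ≤s , _) = begin
    suc e          ≤⟨ m<[1+m/n]*n e 2 ⟩
    suc w * 2      ≤⟨ ℕₚ.*-monoˡ-≤ 2 (ℕₚ.+-mono-≤ 1≤s w≤s) ⟩
    (s ℕ.+ s) * 2  ≡⟨ collect s ⟩
    4 * s          ∎
    where
    open ℕₚ.≤-Reasoning
    w = e / 2
    collect : ∀ s → (s ℕ.+ s) * 2 ≡ 4 * s
    collect = solve-∀
    2w≤e : 2 * w ≤ e
    2w≤e = subst (_≤ e) (ℕₚ.*-comm w 2) (m/n*n≤m e 2)
    1≤s : 1 ≤ s
    1≤s = ℕ→ℝ-cancel-≤ (≤ᴿ-trans {ℕ→ℝ 1} {m ^ᴿ α} {ℕ→ℝ s} (1≤mᵅ m) mᵅ≤s)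
    w≤s : w ≤ s
    w≤s = ℕ→ℝ-cancel-≤ (≤ᴿ-trans {ℕ→ℝ w} {m ^ᴿ α} {ℕ→ℝ s}
      (½-≤⇒half-√-≤-^ᴿ {m} {α} {w} ½≤α (ℕₚ.≤-trans (ℕₚ.*-mono-≤ 2w≤e 2w≤e) (ℕₚ.<⇒≤ (⌈√⌉-pred ⌈√m⌉)))) mᵅ≤s)

  node-memory : ∀ {m d s s-node s-ID} .{{_ : NonZero m}} → IsCeiling (√ m) d → IsCeiling (m ^ᴿ α) s →
    ℕ→ℝ s-node ≤ᴿ c · √ m → s-ID ≤ c * s → s-node ℕ.+ s-ID ≤ 5 * c * s
  node-memory {m} {d} {s} {s-node} {s-ID} ⌈√m⌉ ⌈mᵅ⌉ node≤ ID≤ = begin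
    s-node ℕ.+ s-ID        ≤⟨ ℕₚ.+-mono-≤ node≤′ ID≤ ⟩
    c * d ℕ.+ c * s        ≤⟨ ℕₚ.+-monoˡ-≤ (c * s) (ℕₚ.*-monoʳ-≤ c (⌈√⌉≤4⌈^⌉ ⌈√m⌉ ⌈mᵅ⌉)) ⟩
    c * (4 * s) ℕ.+ c * s  ≡⟨ collect c s ⟩
    5 * c * s              ∎
    where
    open ℕₚ.≤-Reasoning
    collect : ∀ c s → c * (4 * s) ℕ.+ c * s ≡ 5 * c * s
    collect = solve-∀
    node≤′ : s-node ≤ c * d
    node≤′ = ℕ→ℝ-cancel-≤ (≤ᴿ-trans {ℕ→ℝ s-node} {c · √ m} {ℕ→ℝ (c * d)} node≤ (·-≤-ℕ c {√ m} {d} (proj₁ ⌈√m⌉)))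

  -- `M` stands for the accesses of the whole tree and stays fixed in the induction, so `A` bounds
  -- every array of the subtree. The premise m² ≤ M passes to children because g ≤ m.
  subtree-memory : ∀ {M A} .{{_ : NonZero M}} → IsCeiling (M ^ᴿ half α) A →
    ∀ {xs} {T : SAIT α xs} {s} → Accessed xs → accesses xs * accesses xs ≤ M → Ideal T → Memory c T s →
    s ≤ 5 * c * A * length xs
  subtree-memory ⌈Mᵅᐟ²⌉ _ _ _ empty = z≤n
  subtree-memory {M} {A} ⌈Mᵅᐟ²⌉ acc m²≤M ideal
    (node {k′ = k′} {reps = reps} {gaps} {refl} {⌈√m⌉} {_} {array} {_} {s-node} {s-ID} {ss} node≤ ID≤ mems) = begin
    s-node ℕ.+ s-ID ℕ.+ Vec.sum ss       ≤⟨ ℕₚ.+-monoˡ-≤ (Vec.sum ss) (node-memory ⌈√m⌉ size≡ node≤ ID≤) ⟩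
    5 * c * size ℕ.+ Vec.sum ss          ≤⟨ ℕₚ.+-monoˡ-≤ (Vec.sum ss) (ℕₚ.*-monoʳ-≤ (5 * c)
                                              (⌈⌉-mono {m ^ᴿ α} {M ^ᴿ half α} (^ᴿ-half α m²≤M) size≡ ⌈Mᵅᐟ²⌉)) ⟩
    -- A node has at least one representative, so its cost `B` is charged to its own keys.
    B ℕ.+ Vec.sum ss                     ≤⟨ ℕₚ.+-monoˡ-≤ (Vec.sum ss) (ℕₚ.m≤m*n B (suc k′)) ⟩
    B * suc k′ ℕ.+ Vec.sum ss            ≡⟨ rearrange B (suc k′) (Vec.sum ss) ⟩
    1 * Vec.sum ss ℕ.+ B * (suc k′ * 1)  ≤⟨ interleave-sum length 1 length-super 1 B reps gaps ss child ⟩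
    B * length (interleave reps gaps)    ∎
    where
    open ℕₚ.≤-Reasoning
    open InterpolationArray array using (size; size≡)
    m = accesses (interleave reps gaps)
    B = 5 * c * A
    instance
      m≢0 : NonZero m
      m≢0 = ℕ.>-nonZero (interleave-accesses>0 reps gaps acc)
    rearrange : ∀ B k s → B * k ℕ.+ s ≡ 1 * s ℕ.+ B * (k * 1)
    rearrange = solve-∀
    child : ∀ j → 1 * lookup ss j ≤ B * length (lookup gaps j)
    child j = subst (_≤ B * length (lookup gaps j)) (sym (ℕₚ.*-identityˡ _))
      (subtree-memory ⌈Mᵅᐟ²⌉ (interleave-gap reps gaps acc j)
        (ℕₚ.≤-trans (ℕₚ.*-mono-≤ g≤m g≤m) m²≤M) (proj₂ (ideal j)) (mems j))
      where
      g≤m : accesses (lookup gaps j) ≤ m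
      g≤m = ℕₚ.≤-trans (ℕₚ.m≤n*m _ 2) (proj₁ (ideal-child (accesses (lookup gaps j)) (proj₁ (ideal j))))

  -- The root is paid for by its own array, through `G`; each child has g² ≤ m, so all other nodes
  -- are paid for through `F`. Replacing both ceilings by floors doubles the constant 5 to 10.
  memory : ExcludedMiddle 0ℓ → ∀ {xs} {T : SAIT α xs} {s} → Accessed xs → Ideal T → Memory c T s →
    let n = length xs ; m = accesses xs in
    ∃ λ F → ∃ λ G → s ≤ 10 * c * (n * F ℕ.+ G) × ℕ→ℝ F ≤ᴿ m ^ᴿ half α × ℕ→ℝ G ≤ᴿ m ^ᴿ α
  memory em _ _ empty = 0 , 0 , z≤n , 0≤^ᴿ 0 (half α) , 0≤^ᴿ 0 α
  memory em acc ideal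
    (node {reps = reps} {gaps} {refl} {⌈√m⌉} {_} {array} {_} {s-node} {s-ID} {ss} node≤ ID≤ mems) =
    let (A , ⌈mᵅᐟ²⌉)     = ceiling em (m ^ᴿ half α)
        (F , A≤2F , F≤) = ⌈⌉≤2*floor em (m ^ᴿ half α) (1≤mᵅᐟ² m) ⌈mᵅᐟ²⌉
        (G , S≤2G , G≤) = ⌈⌉≤2*floor em (m ^ᴿ α) (1≤mᵅ m) size≡
        child j = subst (_≤ 5 * c * A * length (lookup gaps j)) (sym (ℕₚ.*-identityˡ _))
          (subtree-memory ⌈mᵅᐟ²⌉ (interleave-gap reps gaps acc j)
            (proj₂ (ideal-child (accesses (lookup gaps j)) (proj₁ (ideal j)))) (proj₂ (ideal j)) (mems j))
    in F , G , (begin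
      s-node ℕ.+ s-ID ℕ.+ Vec.sum ss           ≤⟨ ℕₚ.+-mono-≤ (node-memory ⌈√m⌉ size≡ node≤ ID≤) (children A ss child) ⟩
      5 * c * size ℕ.+ 5 * c * A * n           ≤⟨ ℕₚ.+-mono-≤ (ℕₚ.*-monoʳ-≤ (5 * c) S≤2G)
                                                    (ℕₚ.*-monoˡ-≤ n (ℕₚ.*-monoʳ-≤ (5 * c) A≤2F)) ⟩
      5 * c * (2 * G) ℕ.+ 5 * c * (2 * F) * n  ≡⟨ collect c G F n ⟩
      10 * c * (n * F ℕ.+ G)                   ∎) , F≤ , G≤
    where
    open ℕₚ.≤-Reasoning
    open InterpolationArray array using (size; size≡)
    m = accesses (interleave reps gaps)
    n = length (interleave reps gaps)
    instance
      m≢0 : NonZero m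
      m≢0 = ℕ.>-nonZero (interleave-accesses>0 reps gaps acc)
    collect : ∀ c G F n → 5 * c * (2 * G) ℕ.+ 5 * c * (2 * F) * n ≡ 10 * c * (n * F ℕ.+ G)
    collect = solve-∀
    children : ∀ A ss → (∀ j → 1 * lookup ss j ≤ 5 * c * A * length (lookup gaps j)) → Vec.sum ss ≤ 5 * c * A * n
    children A ss bound = ℕₚ.≤-trans (ℕₚ.≤-reflexive (sym (ℕₚ.*-identityˡ _)))
      (ℕₚ.m+n≤o⇒m≤o (1 * Vec.sum ss) (interleave-sum length 1 length-super 1 (5 * c * A) reps gaps ss bound))

-- Assembly of the bounds

-- A rational separating α from 1 is the exponent that bounds m^α. It exceeds ¼, hence is positive,
-- so its absolute numerator is its numerator.
exponent-bound : ∀ {α} → ℚ→ℝ ½ ≤ᴿ α → α <ᴿ ℕ→ℝ 1 → ∃ λ q → ¬ α >ℚ q × ∣ ↥ q ∣ < ↧ₙ q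
exponent-bound {α} ½≤α (q , α≯q , q<1) = q , α≯q , num<den q (>ℚ∧≯ℚ⇒< α (½≤ᴿ⇒>¼ {α} ½≤α) α≯q) q<1
  where
  num<den : ∀ q → ¼ ℚ.< q → q ℚ.< 1ℚ → ∣ ↥ q ∣ < ↧ₙ q
  num<den (mkℚ (+ a) b _)         _        (*<* a<b) =
    ℤₚ.drop‿+<+ (subst₂ ℤ._<_ (ℤₚ.*-identityʳ (+ a)) (ℤₚ.*-identityˡ (+ suc b)) a<b)
  num<den (mkℚ (ℤ.-[1+ a ]) b _) (*<* ()) _

theorem5 : ExcludedMiddle 0ℓ →
    (α : ℝ) → ℚ→ℝ ½ ≤ᴿ α → α <ᴿ ℕ→ℝ 1 →
    (c : ℕ) → Σ ℕ λ C →
    (xs : List Entry) → IsKeySet xs →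
    let n = length xs
        m = accesses xs
    in  (Σ (SAIT α xs) Ideal)
      × ((T : SAIT α xs) → Ideal T →
           (∀ t → BuildTime c T t → t ≤ C * m)
         × (∀ s → Memory c T s →
              ℕ→ℝ s ≤ᴿ C · (n · m ^ᴿ half α +ᴿ m ^ᴿ α)))
theorem5 em α ½≤α α<1 c =
  let (q , α≯q , q<1) = exponent-bound {α} ½≤α α<1
      K = timeConstant q c
      -- The sum dominates both constants, so one `C` serves time and memory.
      C = 3 * K ℕ.+ 10 * c
  in C , λ xs keys →
    let n = length xs
        m = accesses xs
        acc = IsKeySet.accessed keys
        X = m ^ᴿ half α
        Y = m ^ᴿ α
    in ideal-SAIT em α n xs ℕₚ.≤-refl acc ,
       λ T ideal →
         (λ t time → ℕₚ.≤-trans (build-time {α} q α≯q q<1 c acc ideal time) (ℕₚ.*-monoˡ-≤ m (ℕₚ.m≤m+n (3 * K) (10 * c)))) ,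
         (λ s mem →
           let (F , G , s≤ , F≤ , G≤) = memory {α} ½≤α c em acc ideal mem
               N = n * F ℕ.+ G
           in ≤ᴿ-trans {ℕ→ℝ s} {ℕ→ℝ (C * N)} {C · (n · X +ᴿ Y)}
                (ℕ→ℝ-mono-≤ (ℕₚ.≤-trans s≤ (ℕₚ.*-monoˡ-≤ N (ℕₚ.m≤n+m (10 * c) (3 * K)))))
                (·-≥-ℕ C {n · X +ᴿ Y} {N} (+ᴿ-≥-ℕ {n · X} {Y} {n * F} {G} (·-≥-ℕ n {X} {F} F≤) G≤)))
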